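{- Let $\Gamma$ be a graph, and let $n\geq 6$ be an even integer. Then the pair $(\Gamma,C_n)$ is nontrivially unstable if and only if $\Gamma$ is nontrivially unstable and coprime to $C_n$.
   Context: All graphs are finite, undirected, without multiple edges, but possibly with loops; $C_n$ is the cycle of length $n$. For graphs $\Gamma,\Sigma$, the direct product $\Gamma\times\Sigma$ has vertex set $V(\Gamma)\times V(\Sigma)$, with $(u,i)\sim(v,j)$ iff $u\sim v$ in $\Gamma$ and $i\sim j$ in $\Sigma$. The pair $(\Gamma,\Sigma)$ is stable if $\mathrm{Aut}(\Gamma\times\Sigma)=\mathrm{Aut}(\Gamma)\times\mathrm{Aut}(\Sigma)$ (the latter acting componentwise), and unstable otherwise. A graph is twin-free if no two distinct vertices have the same neighborhood. Graphs $\Gamma,\Sigma$ are coprime if there is no graph $\Delta$ with more than one vertex such that $\Gamma\cong\Gamma'\times\Delta$ and $\Sigma\cong\Sigma'\times\Delta$ for some graphs $\Gamma',\Sigma'$. A pair $(\Gamma,\Sigma)$ is nontrivial if $\Gamma$ and $\Sigma$ are coprime connected twin-free graphs and exactly one of them is bipartite; it is nontrivially unstable if it is nontrivial and unstable. A graph $\Gamma$ is unstable if the pair $(\Gamma,K_2)$ is unstable, and $\Gamma$ is nontrivially unstable if it is connected, non-bipartite, twin-free and unstable. -}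

module Defs where

open import Data.Nat using (ℕ; zero; suc; _≤_)
open import Data.Nat.Divisibility using (_∣_)
open import Data.Fin using (Fin; toℕ; combine; remQuot)
open import Data.Fin.Properties using () renaming (_≟_ to _≟ᶠ_)
open import Data.Bool using (Bool; true; false; _∧_; _∨_; not)
open import Data.Bool.Properties using (∨-comm)
open import Data.Product using (Σ; Σ-syntax; ∃; ∃-syntax; _×_; _,_; proj₁; proj₂)
open import Data.Sum using (_⊎_)
open import Relation.Nullary using (¬_)
open import Relation.Nullary.Decidable using (⌊_⌋)
open import Relation.Binary.PropositionalEquality using (_≡_; _≢_; refl; cong₂)
open import Function.Bundles using (_↔_; Inverse)
import Data.Nat as ℕ

-- A finite graph on vertex set Fin size; loops allowed (adj v v may be true),
-- no multiple edges, undirected (symmetric adjacency).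
record Graph : Set where
  field
    size : ℕ
    adj  : Fin size → Fin size → Bool
    sym  : ∀ u v → adj u v ≡ adj v u
open Graph public

Adj : (Γ : Graph) → Fin (size Γ) → Fin (size Γ) → Set
Adj Γ u v = adj Γ u v ≡ true

record Iso (Γ Σ' : Graph) : Set where
  field
    bij  : Fin (size Γ) ↔ Fin (size Σ')
    pres : ∀ u v → adj Σ' (Inverse.to bij u) (Inverse.to bij v) ≡ adj Γ u v
open Iso public

_≅_ : Graph → Graph → Set
Γ ≅ Σ' = Iso Γ Σ'

Aut : Graph → Set
Aut Γ = Iso Γ Γ

⟦_⟧ : ∀ {Γ Σ'} → Iso Γ Σ' → Fin (size Γ) → Fin (size Σ')
⟦ φ ⟧ = Inverse.to (bij φ)

-- Direct (tensor/categorical) product; vertex (u,i) is encoded as combine u i,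
-- with inverse decoding given by remQuot.
fstV : (m k : ℕ) → Fin (m ℕ.* k) → Fin m
fstV m k x = proj₁ (remQuot {m} k x)

sndV : (m k : ℕ) → Fin (m ℕ.* k) → Fin k
sndV m k x = proj₂ (remQuot {m} k x)

_×ᴳ_ : Graph → Graph → Graph
Γ ×ᴳ Σ' = record
  { size = m ℕ.* k
  ; adj  = λ x y → adj Γ (fstV m k x) (fstV m k y) ∧ adj Σ' (sndV m k x) (sndV m k y)
  ; sym  = λ x y → cong₂ _∧_ (Graph.sym Γ (fstV m k x) (fstV m k y))
                             (Graph.sym Σ' (sndV m k x) (sndV m k y))
  }
  where
  m = size Γ
  k = size Σ'

Stable : Graph → Graph → Set
Stable Γ Σ' = (φ : Aut (Γ ×ᴳ Σ')) →
  Σ[ α ∈ Aut Γ ] Σ[ β ∈ Aut Σ' ]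
    (∀ u i → ⟦ φ ⟧ (combine u i) ≡ combine (⟦ α ⟧ u) (⟦ β ⟧ i))

Unstable : Graph → Graph → Set
Unstable Γ Σ' = ¬ Stable Γ Σ'

data Reach (Γ : Graph) (u : Fin (size Γ)) : Fin (size Γ) → Set where
  here : Reach Γ u u
  step : ∀ {v w} → Reach Γ u v → Adj Γ v w → Reach Γ u w

Connected : Graph → Set
Connected Γ = (1 ≤ size Γ) × (∀ u v → Reach Γ u v)

Bipartite : Graph → Set
Bipartite Γ = Σ[ c ∈ (Fin (size Γ) → Bool) ] (∀ u v → Adj Γ u v → c u ≢ c v)

TwinFree : Graph → Set
TwinFree Γ = ∀ u v → (∀ w → adj Γ u w ≡ adj Γ v w) → u ≡ v

Coprime : Graph → Graph → Set
Coprime Γ Σ' = ¬ (Σ[ Δ ∈ Graph ] (2 ≤ size Δ) ×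
                  (Σ[ Γ′ ∈ Graph ] Γ ≅ (Γ′ ×ᴳ Δ)) ×
                  (Σ[ Σ″ ∈ Graph ] Σ' ≅ (Σ″ ×ᴳ Δ)))

Nontrivial : Graph → Graph → Set
Nontrivial Γ Σ' =
  Coprime Γ Σ' × Connected Γ × Connected Σ' × TwinFree Γ × TwinFree Σ' ×
  ((Bipartite Γ × ¬ Bipartite Σ') ⊎ (¬ Bipartite Γ × Bipartite Σ'))

NontriviallyUnstablePair : Graph → Graph → Set
NontriviallyUnstablePair Γ Σ' = Nontrivial Γ Σ' × Unstable Γ Σ'

K₂ : Graph
K₂ = record { size = 2 ; adj = λ i j → not ⌊ i ≟ᶠ j ⌋ ; sym = s }
  where
  s : ∀ (i j : Fin 2) → not ⌊ i ≟ᶠ j ⌋ ≡ not ⌊ j ≟ᶠ i ⌋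
  s Fin.zero Fin.zero = refl
  s Fin.zero (Fin.suc Fin.zero) = refl
  s (Fin.suc Fin.zero) Fin.zero = refl
  s (Fin.suc Fin.zero) (Fin.suc Fin.zero) = refl

succ? : (n : ℕ) → Fin n → Fin n → Bool
succ? n i j = ⌊ suc (toℕ i) ℕ.≟ toℕ j ⌋ ∨ (⌊ suc (toℕ i) ℕ.≟ n ⌋ ∧ ⌊ toℕ j ℕ.≟ 0 ⌋)

C : ℕ → Graph
C n = record { size = n ; adj = λ i j → succ? n i j ∨ succ? n j i
             ; sym = λ i j → ∨-comm (succ? n i j) (succ? n j i) }

UnstableGraph : Graph → Set
UnstableGraph Γ = Unstable Γ K₂

NontriviallyUnstableGraph : Graph → Set
NontriviallyUnstableGraph Γ =
  Connected Γ × ¬ Bipartite Γ × TwinFree Γ × UnstableGraph Γ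

Even : ℕ → Set
Even n = 2 ∣ n

{-# OPTIONS --safe #-}

-- Let R = id × (rotation by 2) on Γ × C_n.  For an automorphism φ, the conjugate
-- F = φ R φ⁻¹ again splits every neighbourhood N(x) into N(x) ∩ N(F x) and
-- N(x) ∩ N(F⁻¹ x).  As Γ is twin-free, this forces F = R^{±1} or F to preserve the
-- C_n-coordinate.  In the first case φ = (α_{i mod 2}(u) , β(i)) for a two-fold
-- automorphism (α₀ , α₁) of Γ, and α₀ = α₁ because (Γ , K₂) is stable.  If both
-- φ R φ⁻¹ and φ⁻¹ R φ preserve the C_n-coordinate, then conjugating reflections of
-- C_n by φ shows that n/2 is odd and that C_{n/2} is a common factor of Γ and C_n.
-- Conversely a two-fold automorphism of Γ acts on Γ × C_n through the bipartition
-- of C_n, so stability of (Γ , C_n) gives stability of (Γ , K₂).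

module Submission where

open import Defs
open import Data.Nat using (ℕ; _≤_)
open import Data.Product using (_×_)
open import Function.Bundles using (_⇔_)

open import Data.Bool using (Bool; true; false; _∧_; _∨_; not)
open import Data.Bool.Properties using (⇔→≡; ∧-conicalˡ; ∧-conicalʳ; ∧-zeroʳ; ∧-identityʳ; ∨-zeroʳ; ¬-not; not-¬; not-involutive)
  renaming (_≟_ to _≟ᵇ_)
open import Data.Fin using (Fin; zero; suc; toℕ; combine; remQuot; punchOut; opposite)
open import Data.Fin.Properties using (any?; injective⇒≤; punchOut-injective; remQuot-combine; combine-remQuot;
  combine-injective; toℕ-injective; toℕ-fromℕ<; toℕ<n; opposite-prop; opposite-involutive; suc-injective)
  renaming (_≟_ to _≟ᶠ_)
open import Data.Nat using (zero; suc; _+_; _*_; _∸_; _<_; z≤n; s≤s; NonZero; >-nonZero; >-nonZero⁻¹)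
open import Data.Nat.Divisibility using (_∣_; divides; divides-refl; ∣-refl; ∣-trans; _∣0; ∣⇒≤; *-cancelʳ-∣; _∣?_; m∣m*n)
open import Data.Nat.DivMod using (_%_; _/_; _mod_; m%n<n; m<n⇒m%n≡m; m%n%n≡m%n; %-distribˡ-+; %-remove-+ˡ;
  m≡m%n+[m/n]*n; [m+n]%n≡m%n; n%n≡0; m∣n⇒o%n%m≡o%m)
open import Data.Nat.GeneralisedArithmetic using (fold; fold-+)
open import Data.Nat.Properties using (_≟_; 1+n≰n; ≤-trans; <⇒≤; <⇒≱; ≤∧≢⇒<; *-cancelʳ-≤; +-comm; +-assoc; +-suc;
  +-identityʳ; +-cancelʳ-≡; *-comm; *-assoc; m∸n+n≡m; m+[n∸m]≡n; +-∸-assoc; n∸n≡0; m*n≢0⇒m≢0)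
open import Data.Product using (Σ-syntax; ∃-syntax; _,_; proj₁; proj₂)
open import Data.Sum using (_⊎_; inj₁; inj₂; [_,_]′)
open import Function.Base using (_∘_; id)
open import Function.Bundles using (Inverse; mk↔ₛ′; mk⇔)
open import Function.Definitions using (Injective)
open import Relation.Binary.PropositionalEquality as ≡
  using (_≡_; _≢_; ≢-sym; refl; cong; cong₂; subst; subst₂; trans; module ≡-Reasoning)
open import Relation.Nullary using (¬_; Dec; yes; no; contradiction)
open import Relation.Nullary.Decidable using (⌊_⌋; _×-dec_; ¬?; from-no; decidable-stable)
open import Relation.Unary using (Decidable)

-- Write n = 2m. The case in which both conjugates preserve the cycle coordinate is a real
-- obstruction: for m odd, C_2m is C_m × K₂, and if Γ is Γ′ × C_m, exchanging the two copies of C_m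
-- in Γ′ × C_m × C_m × K₂ turns R into a map that acts on Γ alone. The proof shows that this is the
-- only way in which it arises. The rotation is by 2 because x and R x must share neighbours for the
-- effect of an automorphism to be read off neighbourhoods. The bound on n enters through n not
-- dividing 4, which keeps i - 1, i + 1 and i + 3 distinct; for n = 4 the rotation by 2 is its own
-- inverse and the two halves of a neighbourhood coincide.

∧-true : ∀ {a b} → a ≡ true → b ≡ true → a ∧ b ≡ true
∧-true refl refl = refl

-- Finite graphs, edges and connectedness

module _ (Γ : Graph) where

  Vertex : Set
  Vertex = Fin (size Γ)

  Adj-sym : ∀ {u v} → Adj Γ u v → Adj Γ v u
  Adj-sym {u} {v} = trans (Graph.sym Γ v u)

base : ∀ {Γ} → Connected Γ → Vertex Γ
base {record { size = suc _ }} _ = zero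

injective⇒surjective : ∀ {n} {f : Fin n → Fin n} → Injective _≡_ _≡_ f → ∀ y → ∃[ x ] f x ≡ y
injective⇒surjective {n} {f} inj y with any? (λ x → f x ≟ᶠ y)
... | yes found = found
injective⇒surjective {suc n} {f} inj y | no none =
  contradiction (injective⇒≤ {f = λ x → punchOut (y≢f x)} (inj ∘ punchOut-injective (y≢f _) (y≢f _)))
    1+n≰n
  where
  y≢f : ∀ x → y ≢ f x
  y≢f x eq = none (x , ≡.sym eq)

-- Finiteness supplies the inverse, so a map built by hand need only be shown injective.
injective⇒Aut : ∀ {Γ} (f : Vertex Γ → Vertex Γ) → Injective _≡_ _≡_ f →
  (∀ u v → adj Γ (f u) (f v) ≡ adj Γ u v) → Σ[ α ∈ Aut Γ ] (∀ u → ⟦ α ⟧ u ≡ f u)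
injective⇒Aut f inj f-pres = record { bij = mk↔ₛ′ f f⁻¹ f∘f⁻¹ (λ u → inj (f∘f⁻¹ (f u))) ; pres = f-pres } , λ _ → refl
  where
  f⁻¹ = λ y → proj₁ (injective⇒surjective inj y)
  f∘f⁻¹ = λ y → proj₂ (injective⇒surjective inj y)

-- Two properties that alternate along edges must both hold everywhere on a
-- connected graph, since otherwise one of them would be a proper 2-colouring.
alternating⇒everywhere : ∀ {Γ} → Connected Γ → ¬ Bipartite Γ →
  {A B : Vertex Γ → Set} → Decidable A → Decidable B →
  (∀ {u v} → Adj Γ u v → A u → B v) → (∀ {u v} → Adj Γ u v → B u → A v) →
  ∀ u → A u → ∀ v → A v × B v
alternating⇒everywhere {Γ} (_ , reach) nonbip {A} {B} A? B? A⇒B B⇒A u a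
  with any? (λ w → A? w ×-dec B? w)
... | yes (w , both) = λ v → propagate (reach w v)
  where
  propagate : ∀ {v} → Reach Γ w v → A v × B v
  propagate here = both
  propagate (step r e) = B⇒A e (proj₂ (propagate r)) , A⇒B e (proj₁ (propagate r))
... | no never = contradiction (colour , proper) nonbip
  where
  colour : Vertex Γ → Bool
  colour v = ⌊ A? v ⌋
  either : ∀ {v} → Reach Γ u v → A v ⊎ B v
  either here = inj₁ a
  either (step r e) = [ inj₂ ∘ A⇒B e , inj₁ ∘ B⇒A e ]′ (either r)
  proper : ∀ v w → Adj Γ v w → colour v ≢ colour w
  proper v w e same with A? v | A? w
  ... | yes p | yes q = never (v , p , A⇒B (Adj-sym Γ e) q)
  ... | no p | no q = [ p , (λ b → q (B⇒A e b)) ]′ (either (reach u v))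

-- The alternation lemma is applied to an always true property, written as the inhabited type
-- `Vertex Γ` so that `yes` decides it, and to the property of having a neighbour, which both ends
-- of any edge have.
neighbour-exists : ∀ {Γ} → Connected Γ → ¬ Bipartite Γ → ∀ u → ∃[ v ] Adj Γ u v
neighbour-exists {Γ} conn nonbip u = proj₂ (alternating⇒everywhere conn nonbip {A = λ _ → Vertex Γ} {B = λ v → ∃[ w ] Adj Γ v w}
  yes (λ v → any? (λ w → adj Γ v w ≟ᵇ true)) (λ {v} e _ → v , Adj-sym Γ e) (λ {v} _ _ → v) u u u)

-- Automorphisms of a direct product, acting on pairs

record Symmetry {X : Set} (E : X → X → Bool) : Set where
  field
    to from : X → X
    to∘from : ∀ x → to (from x) ≡ x
    from∘to : ∀ x → from (to x) ≡ x
    preserves : ∀ x y → E (to x) (to y) ≡ E x y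

  transfer : ∀ {x y} → E x y ≡ true → E (to x) (to y) ≡ true
  transfer {x} {y} = trans (preserves x y)

  to-injective : ∀ {x y} → to x ≡ to y → x ≡ y
  to-injective {x} {y} eq = trans (≡.sym (from∘to x)) (trans (cong from eq) (from∘to y))

open Symmetry

module _ {X : Set} {E : X → X → Bool} where

  infix 8 _⁻¹
  infixr 7 _⊙_

  _⁻¹ : Symmetry E → Symmetry E
  F ⁻¹ = record
    { to = from F ; from = to F ; to∘from = from∘to F ; from∘to = to∘from F
    ; preserves = λ x y → trans (≡.sym (preserves F (from F x) (from F y))) (cong₂ E (to∘from F x) (to∘from F y)) }

  _⊙_ : Symmetry E → Symmetry E → Symmetry E
  F ⊙ G = record
    { to = to F ∘ to G ; from = from G ∘ from F
    ; to∘from = λ x → trans (cong (to F) (to∘from G (from F x))) (to∘from F x)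
    ; from∘to = λ x → trans (cong (from G) (from∘to F (to G x))) (from∘to G x)
    ; preserves = λ x y → trans (preserves F (to G x) (to G y)) (preserves G x y) }

  conjugate : Symmetry E → Symmetry E → Symmetry E
  conjugate φ F = φ ⊙ F ⊙ φ ⁻¹

-- Stability of (Γ , K₂) in a form that mentions no product. The two maps form a two-fold
-- automorphism of Γ; they are plain functions because twin-freeness makes them injective.
TwofoldRigid : Graph → Set
TwofoldRigid Γ = (a : Bool → Vertex Γ → Vertex Γ) → (∀ u v → adj Γ (a false u) (a true v) ≡ adj Γ u v) →
  ∀ u → a false u ≡ a true u

productAdj : (Γ Λ : Graph) → Vertex Γ × Vertex Λ → Vertex Γ × Vertex Λ → Bool
productAdj Γ Λ x y = adj Γ (proj₁ x) (proj₁ y) ∧ adj Λ (proj₂ x) (proj₂ y)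

ProductSymmetry : (Γ Λ : Graph) → Set
ProductSymmetry Γ Λ = Symmetry (productAdj Γ Λ)

module _ {Γ Λ : Graph} where

  Aut⇒Symmetry : Aut (Γ ×ᴳ Λ) → ProductSymmetry Γ Λ
  Aut⇒Symmetry φ = record
    { to = λ { (u , i) → rem (⟦ φ ⟧ (combine u i)) }
    ; from = λ { (u , i) → rem (Inverse.from (bij φ) (combine u i)) }
    ; to∘from = λ { (u , i) → trans (cong (rem ∘ ⟦ φ ⟧) (combine-remQuot {size Γ} (size Λ) _))
                               (trans (cong rem (Inverse.strictlyInverseˡ (bij φ) _)) (remQuot-combine u i)) }
    ; from∘to = λ { (u , i) → trans (cong (rem ∘ Inverse.from (bij φ)) (combine-remQuot {size Γ} (size Λ) _))
                               (trans (cong rem (Inverse.strictlyInverseʳ (bij φ) _)) (remQuot-combine u i)) }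
    ; preserves = λ { (u , i) (v , j) → trans (pres φ (combine u i) (combine v j))
                                         (cong₂ (productAdj Γ Λ) (remQuot-combine u i) (remQuot-combine v j)) }
    }
    where
    rem : Fin (size Γ * size Λ) → Vertex Γ × Vertex Λ
    rem = remQuot {size Γ} (size Λ)

  Splits : ProductSymmetry Γ Λ → Set
  Splits ψ = Σ[ α ∈ (Vertex Γ → Vertex Γ) ] Σ[ β ∈ (Vertex Λ → Vertex Λ) ] (∀ u i → to ψ (u , i) ≡ (α u , β i))

  module _ (edgeΓ : ∃[ u ] ∃[ v ] Adj Γ u v) (edgeΛ : ∃[ i ] ∃[ j ] Adj Λ i j) where

    -- Holding one coordinate on an edge of its factor, whose image is again an edge, reduces the
    -- conjunction to the other factor; so the bare functions preserve adjacency. They inherit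
    -- injectivity from `ψ`.
    splits⇒stable : (∀ ψ → Splits ψ) → Stable Γ Λ
    splits⇒stable splits φ = α , β , λ u i →
      trans (≡.sym (combine-remQuot {size Γ} (size Λ) _)) (cong₂ combine
        (trans (cong proj₁ (ψ-splits u i)) (≡.sym (proj₂ α-Aut u)))
        (trans (cong proj₂ (ψ-splits u i)) (≡.sym (proj₂ β-Aut i))))
      where
      ψ : ProductSymmetry Γ Λ
      ψ = Aut⇒Symmetry φ
      a = proj₁ (splits ψ)
      b = proj₁ (proj₂ (splits ψ))
      ψ-splits = proj₂ (proj₂ (splits ψ))
      u₀ = proj₁ edgeΓ
      v₀ = proj₁ (proj₂ edgeΓ)
      e₀ = proj₂ (proj₂ edgeΓ)
      i₀ = proj₁ edgeΛ
      j₀ = proj₁ (proj₂ edgeΛ)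
      f₀ = proj₂ (proj₂ edgeΛ)
      image : ∀ u v i j → adj Γ (a u) (a v) ∧ adj Λ (b i) (b j) ≡ adj Γ u v ∧ adj Λ i j
      image u v i j = trans (≡.sym (cong₂ (productAdj Γ Λ) (ψ-splits u i) (ψ-splits v j))) (preserves ψ (u , i) (v , j))
      edge-image : adj Γ (a u₀) (a v₀) ∧ adj Λ (b i₀) (b j₀) ≡ true
      edge-image = trans (image u₀ v₀ i₀ j₀) (∧-true e₀ f₀)
      a-injective : Injective _≡_ _≡_ a
      a-injective {u} {v} eq = cong proj₁ (to-injective ψ {u , i₀} {v , i₀}
        (trans (ψ-splits u i₀) (trans (cong (_, b i₀) eq) (≡.sym (ψ-splits v i₀)))))
      b-injective : Injective _≡_ _≡_ b
      b-injective {i} {j} eq = cong proj₂ (to-injective ψ {u₀ , i} {u₀ , j}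
        (trans (ψ-splits u₀ i) (trans (cong (a u₀ ,_) eq) (≡.sym (ψ-splits u₀ j)))))
      a-pres : ∀ u v → adj Γ (a u) (a v) ≡ adj Γ u v
      a-pres u v = trans (≡.sym (∧-identityʳ _)) (trans (cong (adj Γ (a u) (a v) ∧_) (≡.sym (∧-conicalʳ _ _ edge-image)))
        (trans (image u v i₀ j₀) (trans (cong (adj Γ u v ∧_) f₀) (∧-identityʳ _))))
      b-pres : ∀ i j → adj Λ (b i) (b j) ≡ adj Λ i j
      b-pres i j = trans (cong (_∧ adj Λ (b i) (b j)) (≡.sym (∧-conicalˡ _ _ edge-image)))
        (trans (image u₀ v₀ i j) (cong (_∧ adj Λ i j) e₀))
      α-Aut = injective⇒Aut {Γ} a a-injective a-pres
      β-Aut = injective⇒Aut {Λ} b b-injective b-pres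
      α = proj₁ α-Aut
      β = proj₁ β-Aut

  -- A two-fold automorphism (a₀ , a₁) of Γ acts on Γ × Λ through the
  -- bipartition of Λ; stability of the pair forces it to be diagonal.
  stable⇒twofoldRigid : TwinFree Γ → Stable Γ Λ → (c : Vertex Λ → Bool) → (∀ i j → Adj Λ i j → c i ≢ c j) →
    ∀ {i₀ i₁} → Adj Λ i₀ i₁ → TwofoldRigid Γ
  stable⇒twofoldRigid twinFree stable c proper {i₀} {i₁} edge a a-pres u =
    -- The ends of an edge of `Λ` carry both colours, and at either end `a (c i) u` is the same
    -- `⟦ α ⟧ u`.
    both-colours (c i₀) (c i₁) (proper i₀ i₁ edge) (component i₀) (component i₁)
    where
    a-injective : ∀ t → Injective _≡_ _≡_ (a t)
    a-injective false {u} {v} eq = twinFree u v (λ w →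
      trans (≡.sym (a-pres u w)) (trans (cong (λ x → adj Γ x (a true w)) eq) (a-pres v w)))
    a-injective true {u} {v} eq = twinFree u v (λ w →
      trans (Graph.sym Γ u w) (trans (≡.sym (a-pres w u)) (trans (cong (adj Γ (a false w)) eq) (trans (a-pres w v) (Graph.sym Γ w v)))))
    act : Fin (size Γ * size Λ) → Fin (size Γ * size Λ)
    act x = combine (a (c i) v) i
      where
      v = fstV (size Γ) (size Λ) x
      i = sndV (size Γ) (size Λ) x
    act-injective : Injective _≡_ _≡_ act
    act-injective {x} {y} eq with combine-injective _ (sndV (size Γ) (size Λ) x) _ (sndV (size Γ) (size Λ) y) eq
    ... | av≡ , i≡ = trans (≡.sym (combine-remQuot {size Γ} (size Λ) x)) (trans (cong₂ combine v≡ i≡) (combine-remQuot {size Γ} (size Λ) y))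
      where
      v≡ = a-injective (c (sndV (size Γ) (size Λ) x)) (trans av≡ (cong (λ i → a (c i) (fstV (size Γ) (size Λ) y)) (≡.sym i≡)))
    pick-pres : ∀ s t (b : Bool) → (b ≡ true → s ≢ t) → ∀ u v → adj Γ (a s u) (a t v) ∧ b ≡ adj Γ u v ∧ b
    pick-pres s t false _ u v = trans (∧-zeroʳ _) (≡.sym (∧-zeroʳ _))
    pick-pres false true true _ u v = cong (_∧ true) (a-pres u v)
    pick-pres true false true _ u v =
      cong (_∧ true) (trans (Graph.sym Γ _ _) (trans (a-pres v u) (Graph.sym Γ v u)))
    pick-pres false false true d u v = contradiction refl (d refl)
    pick-pres true true true d u v = contradiction refl (d refl)
    act-pres : ∀ x y → adj (Γ ×ᴳ Λ) (act x) (act y) ≡ adj (Γ ×ᴳ Λ) x y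
    act-pres x y = trans (cong₂ (productAdj Γ Λ) (remQuot-combine {size Γ} {size Λ} _ i) (remQuot-combine {size Γ} {size Λ} _ j))
      (pick-pres (c i) (c j) (adj Λ i j) (proper i j) _ _)
      where
      i = sndV (size Γ) (size Λ) x
      j = sndV (size Γ) (size Λ) y
    φ = injective⇒Aut {Γ ×ᴳ Λ} act act-injective act-pres
    α = proj₁ (stable (proj₁ φ))
    β = proj₁ (proj₂ (stable (proj₁ φ)))
    both-colours : ∀ {v} s t → s ≢ t → a s u ≡ v → a t u ≡ v → a false u ≡ a true u
    both-colours false true _ p q = trans p (≡.sym q)
    both-colours true false _ p q = trans q (≡.sym p)
    both-colours false false s≢t _ _ = contradiction refl s≢t
    both-colours true true s≢t _ _ = contradiction refl s≢t
    component : ∀ i → a (c i) u ≡ ⟦ α ⟧ u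
    component i = proj₁ (combine-injective _ i _ (⟦ β ⟧ i) (trans (≡.sym act-at) (proj₂ (proj₂ (stable (proj₁ φ))) u i)))
      where
      act-at : ⟦ proj₁ φ ⟧ (combine u i) ≡ combine (a (c i) u) i
      act-at = trans (proj₂ φ (combine u i)) (cong (λ { (v , j) → combine (a (c j) v) j }) (remQuot-combine {size Γ} {size Λ} u i))

-- Cycle-like graphs

-- A cycle with a chosen direction and length not dividing 4. The direction is data so that
-- `reversed` turns statements about rotation by 2 into statements about its inverse. The last two
-- fields keep i - 1, i + 1 and i + 3 apart.
record Orientation (Λ : Graph) : Set where
  field
    next prev : Vertex Λ → Vertex Λ
    next-prev : ∀ i → next (prev i) ≡ i
    prev-next : ∀ i → prev (next i) ≡ i
    adj-next : ∀ i → Adj Λ i (next i)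
    neighbours : ∀ {i j} → Adj Λ i j → (j ≡ next i) ⊎ (j ≡ prev i)
    next²≢ : ∀ i → next (next i) ≢ i
    next⁴≢ : ∀ i → next (next (next (next i))) ≢ i

  adj-prev : ∀ i → Adj Λ i (prev i)
  adj-prev i = Adj-sym Λ (subst (Adj Λ (prev i)) (next-prev i) (adj-next (prev i)))

  next-injective : ∀ {i j} → next i ≡ next j → i ≡ j
  next-injective {i} {j} eq = trans (≡.sym (prev-next i)) (trans (cong prev eq) (prev-next j))

  next²-prev² : ∀ i → next (next (prev (prev i))) ≡ i
  next²-prev² i = trans (cong next (next-prev (prev i))) (next-prev i)

  prev²-next² : ∀ i → prev (prev (next (next i))) ≡ i
  prev²-next² i = trans (cong prev (prev-next (next i))) (prev-next i)

  next≢prev : ∀ i → next i ≢ prev i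
  next≢prev i eq = next²≢ i (trans (cong next eq) (next-prev i))

  next³≢prev : ∀ i → next (next (next i)) ≢ prev i
  next³≢prev i eq = next⁴≢ i (trans (cong next eq) (next-prev i))

open Orientation

reversed : ∀ {Λ} → Orientation Λ → Orientation Λ
reversed o = record
  { next = prev o ; prev = next o ; next-prev = prev-next o ; prev-next = next-prev o ; adj-next = adj-prev o
  ; neighbours = [ inj₂ , inj₁ ]′ ∘ neighbours o
  ; next²≢ = λ i eq → next²≢ o i (trans (cong (next o ∘ next o) (≡.sym eq)) (next²-prev² o i))
  ; next⁴≢ = λ i eq → next⁴≢ o i (trans (cong (next o ∘ next o ∘ next o ∘ next o) (≡.sym eq))
      (trans (cong (next o ∘ next o) (next²-prev² o _)) (next²-prev² o i)))
  }

next-preserves : ∀ {Λ} (o : Orientation Λ) i j → adj Λ (next o i) (next o j) ≡ adj Λ i j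
next-preserves {Λ} o i j = ⇔→≡ (mk⇔
  (λ e → subst₂ (Adj Λ) (prev-next o i) (prev-next o j) (forth (reversed o) e)) (forth o))
  where
  forth : ∀ (o : Orientation Λ) {i j} → Adj Λ i j → Adj Λ (next o i) (next o j)
  forth o {i} e with neighbours o e
  ... | inj₁ refl = adj-next o (next o i)
  ... | inj₂ refl = subst (Adj Λ (next o i)) (≡.sym (next-prev o i)) (Adj-sym Λ (adj-next o i))

-- Conjugates of the rotation by two

module _ {Γ Λ : Graph} where

  private
    infix 4 _~_
    _~_ : Vertex Γ × Vertex Λ → Vertex Γ × Vertex Λ → Set
    x ~ y = productAdj Γ Λ x y ≡ true

    ~-fst : ∀ {x y} → x ~ y → Adj Γ (proj₁ x) (proj₁ y)
    ~-fst = ∧-conicalˡ _ _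

    ~-snd : ∀ {x y} → x ~ y → Adj Λ (proj₂ x) (proj₂ y)
    ~-snd = ∧-conicalʳ _ _

    ~-sym : ∀ {x y} → x ~ y → y ~ x
    ~-sym e = ∧-true (Adj-sym Γ (~-fst e)) (Adj-sym Λ (~-snd e))

  shift² : Orientation Λ → ProductSymmetry Γ Λ
  shift² o = record
    { to = λ { (u , i) → u , next o (next o i) }
    ; from = λ { (u , i) → u , prev o (prev o i) }
    ; to∘from = λ { (u , i) → cong (u ,_) (next²-prev² o i) }
    ; from∘to = λ { (u , i) → cong (u ,_) (prev²-next² o i) }
    ; preserves = λ { (u , i) (v , j) → cong (adj Γ u v ∧_) (trans (next-preserves o _ _) (next-preserves o i j)) }
    }

  -- N x is the disjoint union of N x ∩ N (F x) and N x ∩ N (F⁻¹ x).  Conjugates of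
  -- shift² inherit this property, which is what pins them down.
  record Halving (F : ProductSymmetry Γ Λ) : Set where
    field
      split : ∀ {x y} → x ~ y → (to F x ~ y) ⊎ (from F x ~ y)
      exclusive : ∀ {x y} → x ~ y → to F x ~ y → ¬ (from F x ~ y)
      meet : ∀ x → ∃[ y ] x ~ y × to F x ~ y

  open Halving

  Halving-⁻¹ : ∀ {F} → Halving F → Halving (F ⁻¹)
  Halving-⁻¹ {F} h = record
    { split = λ e → [ inj₂ , inj₁ ]′ (split h e)
    ; exclusive = λ e e₁ e₂ → exclusive h e e₂ e₁
    ; meet = λ x → let y , e , e′ = meet h (from F x) in y , subst (_~ y) (to∘from F x) e′ , e
    }

  Halving-conjugate : ∀ (φ : ProductSymmetry Γ Λ) {F} → Halving F → Halving (conjugate φ F)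
  Halving-conjugate φ {F} h = record
    { split = λ {x} {y} e → [ inj₁ ∘ forth , inj₂ ∘ forth ]′ (split h (transfer (φ ⁻¹) e))
    ; exclusive = λ {x} {y} e e₁ e₂ → exclusive h (transfer (φ ⁻¹) e) (back e₁) (back e₂)
    ; meet = λ x → let y , e , e′ = meet h (from φ x) in
        to φ y , subst (_~ to φ y) (to∘from φ x) (transfer φ e) , transfer φ e′
    }
    where
    forth : ∀ {z y} → z ~ from φ y → to φ z ~ y
    forth {z} {y} e = subst (to φ z ~_) (to∘from φ y) (transfer φ e)
    back : ∀ {z y} → to φ z ~ y → z ~ from φ y
    back {z} {y} e = subst (_~ from φ y) (from∘to φ z) (transfer (φ ⁻¹) e)

  -- The neighbours of `(u , i)` at level i + 1 form one half, those at i - 1 the other. They do not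
  -- overlap: i + 1 is neither i - 1 nor i - 3, and symmetrically.
  Halving-shift² : (∀ u → ∃[ v ] Adj Γ u v) → ∀ o → Halving (shift² o)
  Halving-shift² nbr o = record
    { split = λ { {u , i} {v , j} e → split-at (~-fst e) (neighbours o (~-snd e)) }
    ; exclusive = λ { {u , i} {v , j} e e₁ e₂ → exclusive-at (neighbours o (~-snd e)) (~-snd e₁) (~-snd e₂) }
    ; meet = λ { (u , i) → let v , e = nbr u in
        (v , next o i) , ∧-true e (adj-next o i) , ∧-true e (Adj-sym Λ (adj-next o (next o i))) }
    }
    where
    split-at : ∀ {u v i j} → Adj Γ u v → (j ≡ next o i) ⊎ (j ≡ prev o i) →
      ((u , next o (next o i)) ~ (v , j)) ⊎ ((u , prev o (prev o i)) ~ (v , j))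
    split-at e (inj₁ refl) = inj₁ (∧-true e (Adj-sym Λ (adj-next o _)))
    split-at e (inj₂ refl) = inj₂ (∧-true e (Adj-sym Λ (adj-prev o _)))
    exclusive-at : ∀ {i j} → (j ≡ next o i) ⊎ (j ≡ prev o i) →
      Adj Λ (next o (next o i)) j → ¬ Adj Λ (prev o (prev o i)) j
    exclusive-at {i} (inj₁ refl) _ e with neighbours o e
    ... | inj₁ eq = next≢prev o i (trans eq (next-prev o (prev o i)))
    ... | inj₂ eq = next³≢prev (reversed o) i (≡.sym eq)
    exclusive-at {i} (inj₂ refl) e _ with neighbours o e
    ... | inj₁ eq = next³≢prev o i (≡.sym eq)
    ... | inj₂ eq = next≢prev o i (≡.sym (trans eq (prev-next o (next o i))))

  -- Only the second coordinate is tested: this is decidable and local, and `moves⇒shifts` recovers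
  -- the first.
  MovesBy² : Orientation Λ → ProductSymmetry Γ Λ → Vertex Γ × Vertex Λ → Set
  MovesBy² o F x = proj₂ (to F x) ≡ next o (next o (proj₂ x))

  image-moves-back : ∀ F o x → MovesBy² o F x → MovesBy² (reversed o) (F ⁻¹) (to F x)
  image-moves-back F o x moved = trans (cong proj₂ (from∘to F x))
    (trans (≡.sym (prev²-next² o (proj₂ x))) (cong (prev o ∘ prev o) (≡.sym moved)))

  module _ {F : ProductSymmetry Γ Λ} (h : Halving F) where

    private
      -- `F x` lies at i + 2 and cannot see i - 1, so `split` hands this neighbour of `x` to
      -- `from F x`.
      inverse-neighbourhood : ∀ (o : Orientation Λ) x → MovesBy² o F x → ∀ {v} → Adj Γ (proj₁ x) v →
        from F x ~ (v , prev o (proj₂ x))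
      inverse-neighbourhood o x@(u , i) moved {v} e with split h {x} {v , prev o i} (∧-true e (adj-prev o i))
      ... | inj₂ e′ = e′
      ... | inj₁ e′ with neighbours o (subst (λ j → Adj Λ j (prev o i)) moved (~-snd e′))
      ...   | inj₁ eq = contradiction (≡.sym eq) (next³≢prev o i)
      ...   | inj₂ eq = contradiction (≡.sym (trans eq (prev-next o (next o i)))) (next≢prev o i)

    -- `from F x` sees level i - 1, so it lies at i - 2 or at i. At i it would be adjacent to the
    -- common neighbour of `x` and `F x` given by `meet`, against `exclusive`.
    moves⇒inverse-moves : ∀ o x → MovesBy² o F x → MovesBy² (reversed o) (F ⁻¹) x
    moves⇒inverse-moves o x@(u , i) moved with meet h x
    ... | y , e , e₁ with neighbours o (Adj-sym Λ (~-snd (inverse-neighbourhood o x moved (~-fst e))))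
    ...   | inj₂ eq = eq
    ...   | inj₁ eq = contradiction (∧-true (~-fst (inverse-neighbourhood o x moved (~-fst e)))
                        (subst (λ j → Adj Λ j (proj₂ y)) (≡.sym (trans eq (next-prev o i))) (~-snd e)))
                        (exclusive h e e₁)

    -- The neighbour at i + 1 must belong to `F x`, since `from F x` lies at i - 2 and sees only i -
    -- 1 and i - 3. The same argument for the inverse at `F x` gives the other inclusion, and then
    -- twin-freeness applies.
    moves⇒neighbourhood⊆ : ∀ o x → MovesBy² o F x → ∀ {v} → Adj Γ (proj₁ x) v → Adj Γ (proj₁ (to F x)) v
    moves⇒neighbourhood⊆ o x@(u , i) moved {v} e with split h {x} {v , next o i} (∧-true e (adj-next o i))
    ... | inj₁ e′ = ~-fst e′
    ... | inj₂ e′ with neighbours o (subst (λ j → Adj Λ j (next o i)) (moves⇒inverse-moves o x moved) (~-snd e′))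
    ...   | inj₁ eq = contradiction (trans eq (next-prev o (prev o i))) (next≢prev o i)
    ...   | inj₂ eq = contradiction (≡.sym eq) (next³≢prev (reversed o) i)

  moves⇒shifts : TwinFree Γ → ∀ {F} → Halving F → ∀ o x → MovesBy² o F x → to F x ≡ to (shift² o) x
  moves⇒shifts twinFree {F} h o x moved = cong₂ _,_ fst≡ moved
    where
    fst≡ : proj₁ (to F x) ≡ proj₁ x
    fst≡ = twinFree _ _ (λ v → ⇔→≡ (mk⇔
      (λ e → subst (λ y → Adj Γ (proj₁ y) v) (from∘to F x)
               (moves⇒neighbourhood⊆ (Halving-⁻¹ h) (reversed o) (to F x) (image-moves-back F o x moved) e))
      (moves⇒neighbourhood⊆ h o x moved)))

  moves-again : ∀ {F} → Halving F → ∀ o x → MovesBy² o F x → MovesBy² o F (to F x)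
  moves-again {F} h o x moved = moves⇒inverse-moves (Halving-⁻¹ h) (reversed o) (to F x)
    (image-moves-back F o x moved)

  -- `y` is adjacent to `x` and to `from F x`, which is (u , i - 2); so `F y` is adjacent to `F x`
  -- and to `x`, at levels i + 2 and i. Only i + 1 fits, two above the level of `y`.
  moves-backward : TwinFree Γ → ∀ {F} → Halving F → ∀ o {x y} → MovesBy² o F x → x ~ y → proj₂ y ≡ prev o (proj₂ x) →
    MovesBy² o F y
  moves-backward twinFree {F} h o {x@(u , i)} {v , _} moved e refl
    with neighbours o (subst (λ z → Adj Λ (proj₂ z) (proj₂ (to F (v , prev o i)))) (to∘from F x) (~-snd (transfer F back)))
    where
    back : from F x ~ (v , prev o i)
    back = subst (_~ (v , prev o i)) (≡.sym (moves⇒shifts twinFree (Halving-⁻¹ h) (reversed o) x (moves⇒inverse-moves h o x moved)))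
             (∧-true (~-fst {x} {v , prev o i} e) (Adj-sym Λ (adj-prev o (prev o i))))
  ... | inj₁ eq = trans eq (cong (next o) (≡.sym (next-prev o i)))
  ... | inj₂ eq with neighbours o (subst (λ j → Adj Λ j (proj₂ (to F (v , prev o i)))) moved (~-snd (transfer F e)))
  ...   | inj₁ eq′ = contradiction (trans (≡.sym eq′) eq) (next³≢prev o i)
  ...   | inj₂ eq′ = contradiction (trans (≡.sym (trans eq′ (prev-next o (next o i)))) eq) (next≢prev o i)

  -- A neighbour at i + 1 lies one step behind `F x`, which moves again; so the backward case covers
  -- both directions.
  moves-along-edge : TwinFree Γ → ∀ {F} → Halving F → ∀ o {x y} → x ~ y → MovesBy² o F x → MovesBy² o F y
  moves-along-edge twinFree {F} h o {x@(u , i)} {y} e moved with neighbours o (~-snd e)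
  ... | inj₂ eq = moves-backward twinFree h o moved e eq
  ... | inj₁ eq = moves-backward twinFree h o (moves-again h o x moved)
      (subst (_~ y) (≡.sym Fx≡) (∧-true (~-fst e) (subst (Adj Λ (next o (next o i))) (≡.sym eq) (Adj-sym Λ (adj-next o (next o i))))))
      (trans eq (trans (≡.sym (prev-next o (next o i))) (cong (prev o) (≡.sym moved))))
    where
    Fx≡ = moves⇒shifts twinFree h o x moved

  -- Connectedness of the product as an induction principle: across an edge of `Λ` the property
  -- alternates between two columns, and non-bipartiteness of `Γ` fills both.
  edge-closed⇒everywhere : Connected Γ → ¬ Bipartite Γ → Connected Λ → (∀ i → ∃[ j ] Adj Λ i j) →
    {P : Vertex Γ × Vertex Λ → Set} → Decidable P → (∀ {x y} → x ~ y → P x → P y) → ∀ x → P x → ∀ y → P y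
  edge-closed⇒everywhere connΓ nonbip connΛ nbr {P} P? closed (u , i) p (v , j) = column (proj₂ connΛ i j) v
    where
    column : ∀ {k} → Reach Λ i k → ∀ w → P (w , k)
    column here w = proj₁ (alternating⇒everywhere connΓ nonbip (λ a → P? (a , i)) (λ a → P? (a , proj₁ (nbr i)))
      (λ e → closed (∧-true e (proj₂ (nbr i)))) (λ e → closed (∧-true e (Adj-sym Λ (proj₂ (nbr i))))) u p w)
    column (step {k} {l} r e′) w = proj₂ (alternating⇒everywhere connΓ nonbip (λ a → P? (a , k)) (λ a → P? (a , l))
      (λ e → closed (∧-true e e′)) (λ e → closed (∧-true e (Adj-sym Λ e′))) u (column r u) w)

  -- A common neighbour of `x` and `F x` lies at i + 1 or i - 1, which leaves i, i + 2 and i - 2 for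
  -- `F x`. One vertex that leaves its level fixes the orientation, and the movement spreads along
  -- edges.
  halving-dichotomy : Connected Γ → ¬ Bipartite Γ → TwinFree Γ → Connected Λ → Orientation Λ →
    ∀ {F} → Halving F → (Σ[ o ∈ Orientation Λ ] ∀ x → to F x ≡ to (shift² o) x) ⊎ (∀ x → proj₂ (to F x) ≡ proj₂ x)
  halving-dichotomy connΓ nonbip twinFree connΛ o {F} h
    with any? (λ u → any? (λ i → ¬? (proj₂ (to F (u , i)) ≟ᶠ i)))
  ... | no fixed = inj₂ (λ { (u , i) → decidable-stable (_ ≟ᶠ _) (λ ne → fixed (u , i , ne)) })
  ... | yes (u , i , ne) = inj₁ (shifts (meet h (u , i)))
    where
    everywhere : ∀ o → MovesBy² o F (u , i) → Σ[ o ∈ Orientation Λ ] ∀ x → to F x ≡ to (shift² o) x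
    everywhere o moved = o , λ x → moves⇒shifts twinFree h o x
      (edge-closed⇒everywhere connΓ nonbip connΛ (λ j → next o j , adj-next o j)
        (λ _ → _ ≟ᶠ _) (moves-along-edge twinFree h o) (u , i) moved x)
    shifts : (∃[ y ] (u , i) ~ y × to F (u , i) ~ y) → Σ[ o ∈ Orientation Λ ] ∀ x → to F x ≡ to (shift² o) x
    shifts ((v , j) , e , e₁) with neighbours o (~-snd e) | neighbours o (~-snd (~-sym e₁))
    ... | inj₁ refl | inj₁ eq = everywhere o eq
    ... | inj₁ refl | inj₂ eq = contradiction (trans eq (prev-next o i)) ne
    ... | inj₂ refl | inj₁ eq = contradiction (trans eq (next-prev o i)) ne
    ... | inj₂ refl | inj₂ eq = everywhere (reversed o) eq

  -- An automorphism normalising ⟨shift²⟩ acts on the first coordinate by a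
  -- two-fold automorphism of Γ, hence diagonally.
  normalising⇒splits : Connected Γ → ¬ Bipartite Γ → Connected Λ → TwofoldRigid Γ → ∀ (o o′ : Orientation Λ) (ψ : ProductSymmetry Γ Λ) →
    (∀ x → to ψ (to (shift² o) x) ≡ to (shift² o′) (to ψ x)) →
    Σ[ s ∈ Splits {Γ} {Λ} ψ ] ∀ i → proj₁ (proj₂ s) (next o i) ≡ next o′ (proj₁ (proj₂ s) i)
  normalising⇒splits connΓ nonbip connΛ diagonal o o′ ψ normal =
    ((λ u → a u i₀) , b u₀ , λ u i → cong₂ _,_ (a-const i i₀ u) (proj₁ (b-const i u))) , λ i → proj₂ (b-const i u₀)
    where
    a : Vertex Γ → Vertex Λ → Vertex Γ
    a u i = proj₁ (to ψ (u , i))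
    b : Vertex Γ → Vertex Λ → Vertex Λ
    b u i = proj₂ (to ψ (u , i))
    u₀ = base connΓ
    i₀ = base connΛ

    two-steps : ∀ v i → next o′ (next o′ (b v (prev o i))) ≡ b v (next o i)
    two-steps v i = trans (cong proj₂ (≡.sym (normal (v , prev o i)))) (cong (b v ∘ next o) (next-prev o i))

    -- The images of (v , i - 1) and (v , i + 1) are neighbours of the image of (u , i), and by
    -- `two-steps` the second lies two ahead of the first. Hence it is the one ahead of `b u i`.
    b-next : ∀ {u v} i → Adj Γ u v → b v (next o i) ≡ next o′ (b u i)
    b-next {u} {v} i e with neighbours o′ (~-snd (transfer ψ {u , i} {v , next o i} (∧-true e (adj-next o i))))
                          | neighbours o′ (~-snd (transfer ψ {u , i} {v , prev o i} (∧-true e (adj-prev o i))))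
    ... | inj₁ eq | _ = eq
    ... | inj₂ eq | inj₁ eq′ = contradiction (trans (cong (next o′ ∘ next o′) (≡.sym eq′)) (trans (two-steps v i) eq))
      (next³≢prev o′ (b u i))
    ... | inj₂ eq | inj₂ eq′ = contradiction (trans (cong (next o′) (≡.sym (trans (cong (next o′) eq′) (next-prev o′ (b u i)))))
      (trans (two-steps v i) eq)) (next≢prev o′ (b u i))

    b-const : ∀ i u → b u i ≡ b u₀ i × b u (next o i) ≡ next o′ (b u₀ i)
    b-const i = alternating⇒everywhere connΓ nonbip (λ _ → _ ≟ᶠ _) (λ _ → _ ≟ᶠ _)
      (λ e eq → trans (b-next i e) (cong (next o′) eq))
      (λ e eq → next-injective o′ (trans (≡.sym (b-next i (Adj-sym Γ e))) eq))
      u₀ refl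

    -- By `b-const` the columns i and i + 1 are carried to two consecutive columns, so the first
    -- coordinates over them form a two-fold automorphism.
    a-next : ∀ i u → a u i ≡ a u (next o i)
    a-next i = diagonal (λ { false u → a u i ; true u → a u (next o i) }) (λ u v →
      trans (≡.sym (∧-identityʳ _)) (trans (cong (adj Γ (a u i) (a v (next o i)) ∧_) (≡.sym (images-adjacent u v)))
        (trans (preserves ψ (u , i) (v , next o i)) (trans (cong (adj Γ u v ∧_) (adj-next o i)) (∧-identityʳ _)))))
      where
      images-adjacent : ∀ u v → Adj Λ (b u i) (b v (next o i))
      images-adjacent u v = subst₂ (Adj Λ) (≡.sym (proj₁ (b-const i u))) (≡.sym (proj₂ (b-const i v))) (adj-next o′ (b u₀ i))

    a-const : ∀ i j u → a u i ≡ a u j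
    a-const i j u = along (proj₂ connΛ i j)
      where
      along : ∀ {k} → Reach Λ i k → a u i ≡ a u k
      along here = refl
      along (step {k} r e) with neighbours o e
      ... | inj₁ refl = trans (along r) (a-next k u)
      ... | inj₂ refl = trans (along r) (trans (cong (a u) (≡.sym (next-prev o k))) (≡.sym (a-next (prev o k) u)))

  -- By twin-freeness ψ (u , i) and ψ (u , i + 2) have the same first coordinate,
  -- so ψ commutes with shift².
  fibrewise⇒constant : Connected Γ → ¬ Bipartite Γ → TwinFree Γ → Connected Λ → TwofoldRigid Γ → Orientation Λ →
    (ψ : ProductSymmetry Γ Λ) → (∀ x → proj₂ (to ψ x) ≡ proj₂ x) →
    Σ[ f ∈ (Vertex Γ → Vertex Γ) ] ∀ u i → to ψ (u , i) ≡ (f u , i)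
  fibrewise⇒constant connΓ nonbip twinFree connΛ rigid o ψ fibrewise =
    proj₁ splits , λ u i → trans (proj₂ (proj₂ splits) u i)
      (cong (proj₁ splits u ,_) (trans (≡.sym (cong proj₂ (proj₂ (proj₂ splits) u i))) (fibrewise (u , i))))
    where
    -- The right-hand side depends on `x` only through its first coordinate. Hence (u , i) and (u ,
    -- i + 2), both facing column i + 1, have images whose first coordinates share their
    -- neighbourhood.
    neighbourhood : ∀ z j x → Adj Λ (proj₂ x) j → adj Γ (proj₁ (to ψ x)) z ≡ adj Γ (proj₁ x) (proj₁ (from ψ (z , j)))
    neighbourhood z j x e = begin
      adj Γ (proj₁ (to ψ x)) z                               ≡⟨ ∧-identityʳ _ ⟨
      adj Γ (proj₁ (to ψ x)) z ∧ true                        ≡⟨ cong (adj Γ (proj₁ (to ψ x)) z ∧_) (trans (cong (λ i → adj Λ i j) (fibrewise x)) e) ⟨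
      productAdj Γ Λ (to ψ x) (z , j)                        ≡⟨ cong (productAdj Γ Λ (to ψ x)) (to∘from ψ (z , j)) ⟨
      productAdj Γ Λ (to ψ x) (to ψ y)                       ≡⟨ preserves ψ x y ⟩
      adj Γ (proj₁ x) (proj₁ y) ∧ adj Λ (proj₂ x) (proj₂ y)  ≡⟨ cong (adj Γ (proj₁ x) (proj₁ y) ∧_) (trans (cong (adj Λ (proj₂ x)) level) e) ⟩
      adj Γ (proj₁ x) (proj₁ y) ∧ true                       ≡⟨ ∧-identityʳ _ ⟩
      adj Γ (proj₁ x) (proj₁ y)                              ∎
      where
      open ≡-Reasoning
      y = from ψ (z , j)
      level : proj₂ y ≡ j
      level = trans (≡.sym (fibrewise y)) (cong proj₂ (to∘from ψ (z , j)))
    commutes : ∀ x → to ψ (to (shift² o) x) ≡ to (shift² o) (to ψ x)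
    commutes x@(u , i) = cong₂ _,_
      (twinFree _ _ (λ z → trans (neighbourhood z (next o i) (to (shift² o) x) (Adj-sym Λ (adj-next o (next o i))))
        (≡.sym (neighbourhood z (next o i) x (adj-next o i)))))
      (trans (fibrewise _) (cong (next o ∘ next o) (≡.sym (fibrewise x))))
    splits : Splits {Γ} {Λ} ψ
    splits = proj₁ (normalising⇒splits connΓ nonbip connΛ rigid o o ψ commutes)

-- Iteration of maps

module _ {A : Set} where

  fold-cong : ∀ {f g : A → A} → (∀ x → f x ≡ g x) → ∀ x l → fold x f l ≡ fold x g l
  fold-cong f≗g x zero = refl
  fold-cong {f} f≗g x (suc l) = trans (cong f (fold-cong f≗g x l)) (f≗g _)

  fold-id : ∀ (x : A) l → fold x id l ≡ x
  fold-id x zero = refl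
  fold-id x (suc l) = fold-id x l

  fold-* : ∀ (f : A → A) k l x → fold x (λ y → fold y f k) l ≡ fold x f (l * k)
  fold-* f k zero x = refl
  fold-* f k (suc l) x = trans (cong (λ y → fold y f k) (fold-* f k l x)) (≡.sym (fold-+ x f k))

  fold-preserves : ∀ {B : Set} {E : A → A → B} {f : A → A} → (∀ x y → E (f x) (f y) ≡ E x y) →
    ∀ x y l → E (fold x f l) (fold y f l) ≡ E x y
  fold-preserves pres x y zero = refl
  fold-preserves pres x y (suc l) = trans (pres _ _) (fold-preserves pres x y l)

fold-intertwine : ∀ {A B : Set} {f : A → A} {g : B → B} (h : A → B) → (∀ x → h (f x) ≡ g (h x)) →
  ∀ x l → h (fold x f l) ≡ fold (h x) g l
fold-intertwine h eq x zero = refl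
fold-intertwine {g = g} h eq x (suc l) = trans (eq _) (cong g (fold-intertwine h eq x l))

-- Cyclic successor

⌊⌋-true : ∀ {P : Set} (d : Dec P) → P → ⌊ d ⌋ ≡ true
⌊⌋-true (yes _) _ = refl
⌊⌋-true (no ¬p) p = contradiction p ¬p

⌊⌋-true⁻¹ : ∀ {P : Set} (d : Dec P) → ⌊ d ⌋ ≡ true → P
⌊⌋-true⁻¹ (yes p) _ = p

∨-true : ∀ {a b} → a ∨ b ≡ true → (a ≡ true) ⊎ (b ≡ true)
∨-true {true} _ = inj₁ refl
∨-true {false} eq = inj₂ eq

toℕ-mod : ∀ a n .{{_ : NonZero n}} → toℕ (a mod n) ≡ a % n
toℕ-mod a n = toℕ-fromℕ< (m%n<n a n)

mod-cong : ∀ {a b} n .{{_ : NonZero n}} → a % n ≡ b % n → a mod n ≡ b mod n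
mod-cong {a} {b} n eq = toℕ-injective (trans (toℕ-mod a n) (trans eq (≡.sym (toℕ-mod b n))))

mod-toℕ : ∀ {n} .{{_ : NonZero n}} (i : Fin n) → toℕ i mod n ≡ i
mod-toℕ {n} i = toℕ-injective (trans (toℕ-mod (toℕ i) n) (m<n⇒m%n≡m (toℕ<n i)))

module _ {n : ℕ} .{{_ : NonZero n}} where

  cycNext : Fin n → Fin n
  cycNext i = suc (toℕ i) mod n

  rot : ℕ → Fin n → Fin n
  rot l i = fold i cycNext l

  cycPrev : Fin n → Fin n
  cycPrev = rot (n ∸ 1)

  cycNext-mod : ∀ a → cycNext (a mod n) ≡ suc a mod n
  cycNext-mod a = mod-cong n (begin
    suc (toℕ (a mod n)) % n     ≡⟨ cong (λ b → suc b % n) (toℕ-mod a n) ⟩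
    suc (a % n) % n             ≡⟨ %-distribˡ-+ 1 (a % n) n ⟩
    (1 % n + a % n % n) % n     ≡⟨ cong (λ b → (1 % n + b) % n) (m%n%n≡m%n a n) ⟩
    (1 % n + a % n) % n         ≡⟨ %-distribˡ-+ 1 a n ⟨
    suc a % n                   ∎)
    where open ≡-Reasoning

  rot-mod : ∀ l a → rot l (a mod n) ≡ (l + a) mod n
  rot-mod zero a = refl
  rot-mod (suc l) a = trans (cong cycNext (rot-mod l a)) (cycNext-mod (l + a))

  rot-≡-mod : ∀ l i → rot l i ≡ (l + toℕ i) mod n
  rot-≡-mod l i = trans (cong (rot l) (≡.sym (mod-toℕ i))) (rot-mod l (toℕ i))

  rot-multiple : ∀ {l} → n ∣ l → ∀ i → rot l i ≡ i
  rot-multiple {l} n∣l i = trans (rot-≡-mod l i) (trans (mod-cong n (%-remove-+ˡ (toℕ i) n∣l)) (mod-toℕ i))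

  rot-fixed⇒∣ : ∀ l i → rot l i ≡ i → n ∣ l
  rot-fixed⇒∣ l i fixed = divides ((l + toℕ i) / n) (+-cancelʳ-≡ (toℕ i) _ _ (begin
    l + toℕ i                                   ≡⟨ m≡m%n+[m/n]*n (l + toℕ i) n ⟩
    (l + toℕ i) % n + (l + toℕ i) / n * n       ≡⟨ cong (_+ (l + toℕ i) / n * n) (toℕ-mod (l + toℕ i) n) ⟨
    toℕ ((l + toℕ i) mod n) + (l + toℕ i) / n * n ≡⟨ cong (λ j → toℕ j + (l + toℕ i) / n * n) (trans (≡.sym (rot-≡-mod l i)) fixed) ⟩
    toℕ i + (l + toℕ i) / n * n                 ≡⟨ +-comm (toℕ i) _ ⟩
    (l + toℕ i) / n * n + toℕ i                 ∎))
    where open ≡-Reasoning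

  rot-transitive : ∀ i j → ∃[ l ] rot l i ≡ j
  rot-transitive i j = l , (begin
    rot l i                              ≡⟨ rot-≡-mod l i ⟩
    (toℕ j + (n ∸ toℕ i) + toℕ i) mod n  ≡⟨ cong (_mod n) (trans (+-assoc (toℕ j) _ _) (cong (toℕ j +_) (m∸n+n≡m (<⇒≤ (toℕ<n i))))) ⟩
    (toℕ j + n) mod n                    ≡⟨ mod-cong n ([m+n]%n≡m%n (toℕ j) n) ⟩
    toℕ j mod n                          ≡⟨ mod-toℕ j ⟩
    j                                    ∎)
    where
    open ≡-Reasoning
    -- Going through a full turn `n` keeps the truncated subtraction exact.
    l = toℕ j + (n ∸ toℕ i)

  rot-suc : ∀ l i → rot l (cycNext i) ≡ cycNext (rot l i)
  rot-suc l i = ≡.sym (fold-intertwine cycNext (λ _ → refl) i l)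

  cycNext-cycPrev : ∀ i → cycNext (cycPrev i) ≡ i
  cycNext-cycPrev i = trans (cong (λ l → rot l i) (trans (+-comm 1 (n ∸ 1)) (m∸n+n≡m (>-nonZero⁻¹ n)))) (rot-multiple ∣-refl i)

  cycPrev-cycNext : ∀ i → cycPrev (cycNext i) ≡ i
  cycPrev-cycNext i = trans (rot-suc (n ∸ 1) i) (cycNext-cycPrev i)

  succ?⇒cycNext : ∀ i j → succ? n i j ≡ true → j ≡ cycNext i
  succ?⇒cycNext i j eq with ∨-true eq
  ... | inj₁ s = trans (≡.sym (mod-toℕ j)) (cong (_mod n) (≡.sym (⌊⌋-true⁻¹ (suc (toℕ i) ≟ toℕ j) s)))
  ... | inj₂ s = toℕ-injective (begin
    toℕ j                 ≡⟨ ⌊⌋-true⁻¹ (toℕ j ≟ 0) (∧-conicalʳ _ _ s) ⟩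
    0                     ≡⟨ n%n≡0 n ⟨
    n % n                 ≡⟨ cong (_% n) (⌊⌋-true⁻¹ (suc (toℕ i) ≟ n) (∧-conicalˡ _ _ s)) ⟨
    suc (toℕ i) % n       ≡⟨ toℕ-mod (suc (toℕ i)) n ⟨
    toℕ (cycNext i)       ∎)
    where open ≡-Reasoning

  toℕ-cycNext : ∀ i → toℕ (cycNext i) ≡ suc (toℕ i) ⊎ (suc (toℕ i) ≡ n × toℕ (cycNext i) ≡ 0)
  toℕ-cycNext i with suc (toℕ i) ≟ n
  ... | yes eq = inj₂ (eq , trans (toℕ-mod (suc (toℕ i)) n) (trans (cong (_% n) eq) (n%n≡0 n)))
  ... | no ne = inj₁ (trans (toℕ-mod (suc (toℕ i)) n) (m<n⇒m%n≡m (≤∧≢⇒< (toℕ<n i) ne)))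

  C-adj-next : ∀ i → Adj (C n) i (cycNext i)
  C-adj-next i = cong (_∨ succ? n (cycNext i) i) succ
    where
    succ : succ? n i (cycNext i) ≡ true
    succ with toℕ-cycNext i
    ... | inj₁ eq = cong (_∨ (⌊ suc (toℕ i) ≟ n ⌋ ∧ ⌊ toℕ (cycNext i) ≟ 0 ⌋)) (⌊⌋-true (suc (toℕ i) ≟ toℕ (cycNext i)) (≡.sym eq))
    ... | inj₂ (last , wraps) = trans (cong (⌊ suc (toℕ i) ≟ toℕ (cycNext i) ⌋ ∨_)
      (∧-true (⌊⌋-true (suc (toℕ i) ≟ n) last) (⌊⌋-true (toℕ (cycNext i) ≟ 0) wraps))) (∨-zeroʳ _)

  C-adj-prev : ∀ (i : Fin n) → Adj (C n) i (cycPrev i)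
  C-adj-prev i = Adj-sym (C n) {cycPrev i} {i} (subst (Adj (C n) (cycPrev i)) (cycNext-cycPrev i) (C-adj-next (cycPrev i)))

  C-neighbours : ∀ {i j} → Adj (C n) i j → (j ≡ cycNext i) ⊎ (j ≡ cycPrev i)
  C-neighbours {i} {j} e with ∨-true {succ? n i j} e
  ... | inj₁ s = inj₁ (succ?⇒cycNext i j s)
  ... | inj₂ s = inj₂ (trans (≡.sym (cycPrev-cycNext j)) (cong cycPrev (≡.sym (succ?⇒cycNext j i s))))

  orientation : ¬ (n ∣ 4) → Orientation (C n)
  orientation n∤4 = record
    { next = cycNext ; prev = cycPrev ; next-prev = cycNext-cycPrev ; prev-next = cycPrev-cycNext
    ; adj-next = C-adj-next ; neighbours = C-neighbours
    ; next²≢ = λ i eq → n∤4 (∣-trans (rot-fixed⇒∣ 2 i eq) (divides 2 refl))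
    ; next⁴≢ = λ i eq → n∤4 (rot-fixed⇒∣ 4 i eq)
    }

  C-connected : Connected (C n)
  C-connected = >-nonZero⁻¹ n , λ i j → subst (Reach (C n) i) (proj₂ (rot-transitive i j)) (walk (proj₁ (rot-transitive i j)))
    where
    walk : ∀ {i} l → Reach (C n) i (rot l i)
    walk zero = here
    walk (suc l) = step (walk l) (C-adj-next _)

  -- `opposite` takes i to n - 1 - i and so reverses the cycle; each reflection below is this map
  -- followed by a rotation.
  cycNext-opposite : ∀ i → cycNext (opposite (cycNext i)) ≡ opposite i
  cycNext-opposite i with toℕ-cycNext i
  ... | inj₁ eq = toℕ-injective (begin
    toℕ (cycNext (opposite (cycNext i)))         ≡⟨ toℕ-mod _ n ⟩
    suc (toℕ (opposite (cycNext i))) % n         ≡⟨ cong (λ a → suc a % n) (trans (opposite-prop (cycNext i)) (cong (λ a → n ∸ suc a) eq)) ⟩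
    suc (n ∸ suc (suc (toℕ i))) % n              ≡⟨ cong (_% n) (≡.sym (+-∸-assoc 1 (subst (_< n) eq (toℕ<n (cycNext i))))) ⟩
    (n ∸ suc (toℕ i)) % n                        ≡⟨ cong (_% n) (opposite-prop i) ⟨
    toℕ (opposite i) % n                         ≡⟨ m<n⇒m%n≡m (toℕ<n (opposite i)) ⟩
    toℕ (opposite i)                             ∎)
    where open ≡-Reasoning
  ... | inj₂ (last , wraps) = toℕ-injective (begin
    toℕ (cycNext (opposite (cycNext i)))         ≡⟨ toℕ-mod _ n ⟩
    suc (toℕ (opposite (cycNext i))) % n         ≡⟨ cong (λ a → suc a % n) (trans (opposite-prop (cycNext i)) (cong (λ a → n ∸ suc a) wraps)) ⟩
    suc (n ∸ 1) % n                              ≡⟨ cong (_% n) (trans (+-comm 1 (n ∸ 1)) (m∸n+n≡m (>-nonZero⁻¹ n))) ⟩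
    n % n                                        ≡⟨ n%n≡0 n ⟩
    0                                            ≡⟨ n∸n≡0 n ⟨
    n ∸ n                                        ≡⟨ cong (n ∸_) last ⟨
    n ∸ suc (toℕ i)                              ≡⟨ opposite-prop i ⟨
    toℕ (opposite i)                             ∎)
    where open ≡-Reasoning

module _ {n d : ℕ} .{{_ : NonZero n}} .{{_ : NonZero d}} (d∣n : d ∣ n) where

  -- The covering of the short cycle by the long one, used with d = 2 for the bipartition and with d
  -- = n / 2 for the levels of the factor.
  reduce : Fin n → Fin d
  reduce i = toℕ i mod d

  reduce-next : ∀ i → reduce (cycNext i) ≡ cycNext (reduce i)
  reduce-next i = begin
    toℕ (suc (toℕ i) mod n) mod d  ≡⟨ cong (_mod d) (toℕ-mod (suc (toℕ i)) n) ⟩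
    suc (toℕ i) % n mod d          ≡⟨ mod-cong d (m∣n⇒o%n%m≡o%m d n (suc (toℕ i)) d∣n) ⟩
    suc (toℕ i) mod d              ≡⟨ cycNext-mod (toℕ i) ⟨
    cycNext (toℕ i mod d)          ∎
    where open ≡-Reasoning

  reduce-prev : ∀ i → reduce (cycPrev i) ≡ cycPrev (reduce i)
  reduce-prev i = trans (≡.sym (cycPrev-cycNext (reduce (cycPrev i))))
    (cong cycPrev (trans (≡.sym (reduce-next (cycPrev i))) (cong reduce (cycNext-cycPrev i))))

  reduce-rot : ∀ l i → reduce (rot l i) ≡ rot l (reduce i)
  reduce-rot l i = fold-intertwine reduce reduce-next i l

  reduce-adj : ∀ {i j} → Adj (C n) i j → Adj (C d) (reduce i) (reduce j)
  reduce-adj {i} {j} e with C-neighbours {i = i} {j = j} e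
  ... | inj₁ refl = subst (Adj (C d) (reduce i)) (≡.sym (reduce-next i)) (C-adj-next (reduce i))
  ... | inj₂ refl = subst (Adj (C d) (reduce i)) (≡.sym (reduce-prev i)) (C-adj-prev (reduce i))

-- Splitting off a cycle as a direct factor

-- Vertex sets have the form `Fin count`, so the fibre of `level` that becomes the cofactor has to
-- be renumbered.
record Enumeration {n : ℕ} (P : Fin n → Set) : Set where
  field
    count : ℕ
    element : Fin count → Fin n
    member : ∀ w → P (element w)
    index : ∀ u → P u → Fin count
    element-index : ∀ u p → element (index u p) ≡ u
    element-injective : Injective _≡_ _≡_ element

enumerate : ∀ {n} {P : Fin n → Set} → Decidable P → Enumeration P
enumerate {zero} P? = record
  { count = 0 ; element = λ () ; member = λ () ; index = λ () ; element-index = λ () ; element-injective = λ { {()} } }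
enumerate {suc n} {P} P? with enumerate (P? ∘ suc) | P? zero
... | rest | no ¬p = record
  { count = count
  ; element = suc ∘ element
  ; member = member
  ; index = λ { zero p → contradiction p ¬p ; (suc u) p → index u p }
  ; element-index = λ { zero p → contradiction p ¬p ; (suc u) p → cong suc (element-index u p) }
  ; element-injective = element-injective ∘ suc-injective
  }
  where open Enumeration rest
... | rest | yes p₀ = record
  { count = suc count
  ; element = λ { zero → zero ; (suc w) → suc (element w) }
  ; member = λ { zero → p₀ ; (suc w) → member w }
  ; index = λ { zero _ → zero ; (suc u) p → suc (index u p) }
  ; element-index = λ { zero _ → refl ; (suc u) p → cong suc (element-index u p) }
  ; element-injective = λ { {zero} {zero} _ → refl ; {suc _} {suc _} eq → cong suc (element-injective (suc-injective eq)) }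
  }
  where open Enumeration rest

-- The last field makes adjacency of u and v depend only on the levels and on
-- the lift-orbits, which is why Γ is the product of a fibre of level with C m.
record CyclicQuotient (Γ : Graph) (m : ℕ) .{{_ : NonZero m}} : Set where
  field
    level : Vertex Γ → Fin m
    lift : Vertex Γ → Vertex Γ
    lift-pres : ∀ u v → adj Γ (lift u) (lift v) ≡ adj Γ u v
    lift-order : ∀ u → fold u lift m ≡ u
    level-lift : ∀ u → level (lift u) ≡ cycNext (level u)
    level-adj : ∀ {u v} → Adj Γ u v → Adj (C m) (level u) (level v)
    lift²-adj : ∀ {u v} → Adj Γ u v → level v ≡ cycNext (level u) → Adj Γ (lift (lift u)) v

module _ {Γ : Graph} {m : ℕ} .{{_ : NonZero m}} (quotient : CyclicQuotient Γ m) where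

  open CyclicQuotient quotient

  private
    bottom : Fin m
    bottom = 0 mod m

    open Enumeration (enumerate (λ u → level u ≟ᶠ bottom))

    raise : ℕ → Vertex Γ → Vertex Γ
    raise l u = fold u lift l

    level-raise : ∀ l u → level (raise l u) ≡ rot l (level u)
    level-raise l u = fold-intertwine level level-lift u l

    raise-adj : ∀ l {u v} → Adj Γ u v → Adj Γ (raise l u) (raise l v)
    raise-adj l = trans (fold-preserves lift-pres _ _ l)

    raise-adj⁻¹ : ∀ l {u v} → Adj Γ (raise l u) (raise l v) → Adj Γ u v
    raise-adj⁻¹ l = trans (≡.sym (fold-preserves lift-pres _ _ l))

    raise-lift : ∀ l u → raise l (lift u) ≡ lift (raise l u)
    raise-lift l u = ≡.sym (fold-intertwine lift (λ _ → refl) u l)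

    raise-cycNext : ∀ j u → raise (toℕ (cycNext j)) u ≡ lift (raise (toℕ j) u)
    raise-cycNext j u with toℕ-cycNext j
    ... | inj₁ eq = cong (λ l → raise l u) eq
    ... | inj₂ (last , wraps) = trans (cong (λ l → raise l u) wraps) (trans (≡.sym (lift-order u)) (cong (λ l → raise l u) (≡.sym last)))

    raise-complement : ∀ (j : Fin m) u → raise (m ∸ toℕ j) (raise (toℕ j) u) ≡ u
    raise-complement j u = trans (≡.sym (fold-+ u lift (m ∸ toℕ j)))
      (trans (cong (λ l → raise l u) (m∸n+n≡m (<⇒≤ (toℕ<n j)))) (lift-order u))

    complement-raise : ∀ (j : Fin m) u → raise (toℕ j) (raise (m ∸ toℕ j) u) ≡ u
    complement-raise j u = trans (≡.sym (fold-+ u lift (toℕ j)))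
      (trans (cong (λ l → raise l u) (m+[n∸m]≡n (<⇒≤ (toℕ<n j)))) (lift-order u))

    level-raise-element : ∀ j w → level (raise (toℕ j) (element w)) ≡ j
    level-raise-element j w = begin
      level (raise (toℕ j) (element w))  ≡⟨ level-raise (toℕ j) (element w) ⟩
      rot (toℕ j) (level (element w))    ≡⟨ cong (rot (toℕ j)) (member w) ⟩
      rot (toℕ j) bottom                 ≡⟨ rot-mod (toℕ j) 0 ⟩
      (toℕ j + 0) mod m                  ≡⟨ cong (_mod m) (+-identityʳ (toℕ j)) ⟩
      toℕ j mod m                        ≡⟨ mod-toℕ j ⟩
      j                                  ∎
      where open ≡-Reasoning

    descend : Vertex Γ → Vertex Γ
    descend u = raise (m ∸ toℕ (level u)) u

    level-descend : ∀ u → level (descend u) ≡ bottom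
    level-descend u = begin
      level (descend u)                          ≡⟨ level-raise (m ∸ toℕ (level u)) u ⟩
      rot (m ∸ toℕ (level u)) (level u)          ≡⟨ rot-≡-mod (m ∸ toℕ (level u)) (level u) ⟩
      (m ∸ toℕ (level u) + toℕ (level u)) mod m  ≡⟨ cong (_mod m) (m∸n+n≡m (<⇒≤ (toℕ<n (level u)))) ⟩
      m mod m                                    ≡⟨ mod-cong m ([m+n]%n≡m%n 0 m) ⟩
      bottom                                     ∎
      where open ≡-Reasoning

    -- With equal levels, `lift u` is one level above `v`; `lift²-adj` on the edge from `v` to
    -- `lift u` joins `lift (lift v)` to `lift u`, and one `lift` cancels.
    lift-swap : ∀ {u v} → level u ≡ level v → Adj Γ (lift u) v → Adj Γ (lift v) u
    lift-swap {u} {v} eq e = trans (≡.sym (lift-pres _ _))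
      (lift²-adj (Adj-sym Γ e) (trans (level-lift u) (cong cycNext eq)))

    -- Neighbours lie on consecutive levels, so one end is lifted before comparing.
    floor : Graph
    floor = record
      { size = count
      ; adj = λ w w′ → adj Γ (lift (element w)) (element w′)
      ; sym = λ w w′ → ⇔→≡ (mk⇔
          (lift-swap (trans (member w) (≡.sym (member w′))))
          (lift-swap (trans (member w′) (≡.sym (member w)))))
      }

    assemble : Vertex floor × Fin m → Vertex Γ
    assemble (w , j) = raise (toℕ j) (element w)

    -- Here the end over `w′` is the upper one. `lift²-adj` raises the lower end by two, and
    -- cancelling one `lift` and then `raise` leaves an edge of `floor`.
    floor-edge : ∀ {w w′} j → Adj Γ (raise (toℕ j) (element w)) (raise (toℕ (cycNext j)) (element w′)) → Adj floor w w′
    floor-edge {w} {w′} j e = raise-adj⁻¹ (toℕ j) (subst (λ u → Adj Γ u (raise (toℕ j) (element w′)))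
      (≡.sym (raise-lift (toℕ j) (element w)))
      (trans (≡.sym (lift-pres _ _)) (lift²-adj (subst (Adj Γ _) (raise-cycNext j (element w′)) e) step-up)))
      where
      step-up : level (lift (raise (toℕ j) (element w′))) ≡ cycNext (level (raise (toℕ j) (element w)))
      step-up = trans (level-lift _) (cong cycNext (trans (level-raise-element j w′) (≡.sym (level-raise-element j w))))

    assemble-edge : ∀ {w w′} j → Adj floor w w′ → Adj Γ (raise (toℕ (cycNext j)) (element w)) (raise (toℕ j) (element w′))
    assemble-edge {w} j e = subst (λ u → Adj Γ u _)
      (trans (raise-lift (toℕ j) (element w)) (≡.sym (raise-cycNext j (element w)))) (raise-adj (toℕ j) e)

    assemble-pres : ∀ x y → adj Γ (assemble x) (assemble y) ≡ productAdj floor (C m) x y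
    assemble-pres (w , j) (w′ , k) = ⇔→≡ (mk⇔ forth back)
      where
      forth : Adj Γ (assemble (w , j)) (assemble (w′ , k)) → productAdj floor (C m) (w , j) (w′ , k) ≡ true
      forth e = ∧-true (edge (C-neighbours {i = j} {j = k} jk)) jk
        where
        jk : Adj (C m) j k
        jk = subst₂ (Adj (C m)) (level-raise-element j w) (level-raise-element k w′) (level-adj e)
        edge : (k ≡ cycNext j) ⊎ (k ≡ cycPrev j) → Adj floor w w′
        edge (inj₁ refl) = floor-edge j e
        edge (inj₂ refl) = Adj-sym floor {w′} {w} (floor-edge k
          (subst (λ i → Adj Γ (assemble (w′ , k)) (assemble (w , i))) (≡.sym (cycNext-cycPrev j)) (Adj-sym Γ e)))
      back : productAdj floor (C m) (w , j) (w′ , k) ≡ true → Adj Γ (assemble (w , j)) (assemble (w′ , k))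
      back e = edge (C-neighbours {i = j} {j = k} (∧-conicalʳ _ _ e))
        where
        edge : (k ≡ cycNext j) ⊎ (k ≡ cycPrev j) → Adj Γ (assemble (w , j)) (assemble (w′ , k))
        edge (inj₁ refl) = Adj-sym Γ (assemble-edge j (Adj-sym floor {w} {w′} (∧-conicalˡ _ _ e)))
        edge (inj₂ refl) = subst (λ i → Adj Γ (assemble (w , i)) (assemble (w′ , k))) (cycNext-cycPrev j)
          (assemble-edge k (∧-conicalˡ _ _ e))

    disassemble : Vertex Γ → Vertex floor × Fin m
    disassemble u = index (descend u) (level-descend u) , level u

    assemble-disassemble : ∀ u → assemble (disassemble u) ≡ u
    assemble-disassemble u = trans (cong (raise (toℕ (level u))) (element-index (descend u) (level-descend u)))
      (complement-raise (level u) u)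

    disassemble-assemble : ∀ x → disassemble (assemble x) ≡ x
    disassemble-assemble (w , j) = cong₂ _,_
      (element-injective (trans (element-index _ _)
        (trans (cong (λ i → raise (m ∸ toℕ i) (assemble (w , j))) (level-raise-element j w)) (raise-complement j (element w)))))
      (level-raise-element j w)

  cyclicFactor : Σ[ Γ′ ∈ Graph ] Γ ≅ (Γ′ ×ᴳ C m)
  cyclicFactor = floor , record
    { bij = mk↔ₛ′ (λ u → combine (proj₁ (disassemble u)) (level u)) (assemble ∘ split)
        (λ x → trans (cong (λ y → combine (proj₁ y) (proj₂ y)) (disassemble-assemble (split x))) (combine-remQuot {count} m x))
        (λ u → trans (cong assemble (remQuot-combine {count} {m} _ _)) (assemble-disassemble u))
    ; pres = λ u v → trans (cong₂ (productAdj floor (C m)) (remQuot-combine {count} {m} _ _) (remQuot-combine {count} {m} _ _))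
        (trans (≡.sym (assemble-pres (disassemble u) (disassemble v)))
          (cong₂ (adj Γ) (assemble-disassemble u) (assemble-disassemble v)))
    }
    where
    split : Fin (count * m) → Vertex floor × Fin m
    split = remQuot {count} m

-- Cycles of even length

module _ {n : ℕ} .{{_ : NonZero n}} where

  rot-reverse : (τ : Fin n → Fin n) → (∀ i → cycNext (τ (cycNext i)) ≡ τ i) → ∀ l i → rot l (τ (rot l i)) ≡ τ i
  rot-reverse τ reverses zero i = refl
  rot-reverse τ reverses (suc l) i = trans (≡.sym (rot-suc l _)) (trans (cong (rot l) (reverses (rot l i))) (rot-reverse τ reverses l i))

  -- The reflection of the cycle through `k`: the rotation brings `opposite k` back to `k`.
  reflect : Fin n → Fin n → Fin n
  reflect k i = rot (proj₁ (rot-transitive (opposite k) k)) (opposite i)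

  reflect-fixes : ∀ k → reflect k k ≡ k
  reflect-fixes k = proj₂ (rot-transitive (opposite k) k)

  reflect-reverses : ∀ k i → cycNext (reflect k (cycNext i)) ≡ reflect k i
  reflect-reverses k i = trans (≡.sym (rot-suc l (opposite (cycNext i)))) (cong (rot l) (cycNext-opposite i))
    where
    l = proj₁ (rot-transitive (opposite k) k)

  reflect-involutive : ∀ k i → reflect k (reflect k i) ≡ i
  reflect-involutive k i = trans (rot-reverse opposite cycNext-opposite (proj₁ (rot-transitive (opposite k) k)) (opposite i))
    (opposite-involutive i)

  reflect-adj : ∀ k i j → Adj (C n) i j → Adj (C n) (reflect k i) (reflect k j)
  reflect-adj k i j e with C-neighbours {i = i} {j = j} e
  ... | inj₁ refl = Adj-sym (C n) {reflect k (cycNext i)} {reflect k i}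
    (subst (Adj (C n) (reflect k (cycNext i))) (reflect-reverses k i) (C-adj-next _))
  ... | inj₂ refl = subst (λ i′ → Adj (C n) (reflect k i′) (reflect k (cycPrev i))) (cycNext-cycPrev i)
    (subst (Adj (C n) (reflect k (cycNext (cycPrev i)))) (reflect-reverses k (cycPrev i)) (C-adj-next _))

  reflection : ∀ {Γ} → Fin n → ProductSymmetry Γ (C n)
  reflection {Γ} k = record
    { to = λ { (u , i) → u , reflect k i }
    ; from = λ { (u , i) → u , reflect k i }
    ; to∘from = λ { (u , i) → cong (u ,_) (reflect-involutive k i) }
    ; from∘to = λ { (u , i) → cong (u ,_) (reflect-involutive k i) }
    ; preserves = λ { (u , i) (v , j) → cong (adj Γ u v ∧_) (⇔→≡ (mk⇔
        (λ e → subst₂ (Adj (C n)) (reflect-involutive k i) (reflect-involutive k j) (reflect-adj k _ _ e))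
        (reflect-adj k i j))) }
    }

  -- The reflection through `k` sends k + l to k - l.
  reflect-fixed⇒∣ : ∀ k l → reflect k (rot l k) ≡ rot l k → n ∣ l + l
  reflect-fixed⇒∣ k l fixed = rot-fixed⇒∣ (l + l) k (begin
    rot (l + l) k              ≡⟨ fold-+ k cycNext l ⟩
    rot l (rot l k)            ≡⟨ cong (rot l) fixed ⟨
    rot l (reflect k (rot l k)) ≡⟨ rot-reverse (reflect k) (reflect-reverses k) l k ⟩
    reflect k k                ≡⟨ reflect-fixes k ⟩
    k                          ∎)
    where open ≡-Reasoning

  module _ (2∣n : 2 ∣ n) where

    colour : Fin n → Bool
    colour i = ⌊ reduce 2∣n i ≟ᶠ zero ⌋

    colour-next : ∀ i → colour i ≢ colour (cycNext i)
    colour-next i eq = alternates (reduce 2∣n i) (trans eq (cong (λ r → ⌊ r ≟ᶠ zero ⌋) (reduce-next 2∣n i)))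
      where
      alternates : ∀ (r : Fin 2) → ⌊ r ≟ᶠ zero ⌋ ≢ ⌊ cycNext r ≟ᶠ zero ⌋
      alternates zero ()
      alternates (suc zero) ()

    colour-proper : ∀ i j → Adj (C n) i j → colour i ≢ colour j
    colour-proper i j e with C-neighbours {i = i} {j = j} e
    ... | inj₁ refl = colour-next i
    ... | inj₂ refl = λ eq → colour-next (cycPrev i) (≡.sym (trans (cong colour (cycNext-cycPrev i)) eq))

    colour-rot : ∀ {l} → 2 ∣ l → ∀ i → colour (rot l i) ≡ colour i
    colour-rot {l} 2∣l i = cong (λ r → ⌊ r ≟ᶠ zero ⌋) (trans (reduce-rot 2∣n l i) (rot-multiple 2∣l (reduce 2∣n i)))

k*2≡k+k : ∀ k → k * 2 ≡ k + k
k*2≡k+k k = trans (*-comm k 2) (cong (k +_) (+-identityʳ k))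

odd⇒suc-even : ∀ {m} → ¬ (2 ∣ m) → ∃[ h ] suc m ≡ h * 2
odd⇒suc-even {m} 2∤m with m % 2 in eq | m≡m%n+[m/n]*n m 2 | m%n<n m 2
... | 0 | m≡ | _ = contradiction (divides (m / 2) m≡) 2∤m
... | 1 | m≡ | _ = suc (m / 2) , cong suc m≡
... | suc (suc _) | _ | s≤s (s≤s ())

-- The only odd divisor of 4 is 1, and 2 divides 4. This provides an `Orientation` of `C m` as well.
odd∤4 : ∀ m → ¬ (2 ∣ m) → ¬ (m * 2 ∣ 4) → ¬ (m ∣ 4)
odd∤4 m 2∤m n∤4 m∣4 = small m (∣⇒≤ m∣4) 2∤m n∤4 m∣4
  where
  small : ∀ m → m ≤ 4 → ¬ (2 ∣ m) → ¬ (m * 2 ∣ 4) → ¬ (m ∣ 4)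
  small 0 _ 2∤m _ _ = 2∤m (2 ∣0)
  small 1 _ _ n∤4 _ = n∤4 (divides 2 refl)
  small 2 _ 2∤m _ _ = 2∤m ∣-refl
  small 3 _ _ _ m∣4 = from-no (3 ∣? 4) m∣4
  small 4 _ 2∤m _ _ = 2∤m (divides 2 refl)
  small (suc (suc (suc (suc (suc _))))) (s≤s (s≤s (s≤s (s≤s ()))))

rot-cancel : ∀ {n} .{{_ : NonZero n}} {l} → n ∣ l → ∀ k i → rot {n} (k + l) i ≡ rot k i
rot-cancel {l = l} n∣l k i = trans (fold-+ i cycNext k) (cong (rot k) (rot-multiple n∣l i))

module _ {m : ℕ} .{{_ : NonZero m}} .{{_ : NonZero (m * 2)}} (m∤4 : ¬ (m ∣ 4)) (h : ℕ) (m-odd : suc m ≡ h * 2) where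

  private
    m∣n : m ∣ m * 2
    m∣n = m∣m*n 2

    o : Orientation (C (m * 2))
    o = orientation (m∤4 ∘ ∣-trans m∣n)

  -- Rotation by m + 1 is even and congruent to 1 modulo m.
  C-quotient : CyclicQuotient (C (m * 2)) m
  C-quotient = record
    { level = reduce m∣n
    ; lift = rot (suc m)
    ; lift-pres = λ i j → fold-preserves {E = adj (C (m * 2))} {f = cycNext} (next-preserves o) i j (suc m)
    ; lift-order = λ i → trans (fold-* cycNext (suc m) m i) (rot-multiple n∣ i)
    ; level-lift = λ i → trans (reduce-rot m∣n (suc m) i) (rot-cancel ∣-refl 1 (reduce m∣n i))
    ; level-adj = λ {i} {j} → reduce-adj m∣n {i} {j}
    ; lift²-adj = λ {i} {j} e up → subst (λ k → Adj (C (m * 2)) k j) (≡.sym (lift² i)) (ahead i j (C-neighbours {i = i} {j = j} e) up)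
    }
    where
    n∣ : m * 2 ∣ m * suc m
    n∣ = divides h (trans (cong (m *_) m-odd) (trans (≡.sym (*-assoc m h 2)) (trans (cong (_* 2) (*-comm m h)) (*-assoc h m 2))))
    -- 2 (m + 1) = n + 2, so lifting twice is rotation by 2.
    lift² : ∀ i → rot (suc m) (rot (suc m) i) ≡ cycNext (cycNext i)
    lift² i = trans (≡.sym (fold-+ i cycNext (suc m)))
      (trans (cong (λ l → rot (suc l) i) (trans (+-suc m m) (cong suc (≡.sym (k*2≡k+k m)))))
        (rot-cancel ∣-refl 2 i))
    ahead : ∀ i j → (j ≡ cycNext i) ⊎ (j ≡ cycPrev i) → reduce m∣n j ≡ cycNext (reduce m∣n i) → Adj (C (m * 2)) (cycNext (cycNext i)) j
    ahead i _ (inj₁ refl) _ = Adj-sym (C (m * 2)) {cycNext i} {cycNext (cycNext i)} (C-adj-next (cycNext i))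
    ahead i _ (inj₂ refl) up = contradiction (trans (≡.sym up) (reduce-prev m∣n i)) (next≢prev (orientation m∤4) (reduce m∣n i))

-- If φ carries the cycle direction of Γ × C_2m into the fibres of the second
-- projection and so does φ⁻¹, then m is odd and C_m is a factor of both Γ and C_2m.
module _ {Γ : Graph} {m : ℕ} .{{_ : NonZero m}} .{{_ : NonZero (m * 2)}} (n∤4 : ¬ (m * 2 ∣ 4))
  (connΓ : Connected Γ) (nonbip : ¬ Bipartite Γ) (twinFree : TwinFree Γ) (rigid : TwofoldRigid Γ)
  where

  private
    n : ℕ
    n = m * 2

    Λ : Graph
    Λ = C n

    o : Orientation Λ
    o = orientation n∤4

    i₀ : Fin n
    i₀ = 0 mod n

    R : ProductSymmetry Γ Λ
    R = shift² {Γ} o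

  module _ (φ : ProductSymmetry Γ Λ)
    (F-fibrewise : ∀ x → proj₂ (to (conjugate φ R) x) ≡ proj₂ x)
    (G-fibrewise : ∀ x → proj₂ (to (conjugate (φ ⁻¹) R) x) ≡ proj₂ x)
    where

    private
      F G : ProductSymmetry Γ Λ
      F = conjugate φ R
      G = conjugate (φ ⁻¹) R

      F-constant : Σ[ f ∈ (Vertex Γ → Vertex Γ) ] ∀ u i → to F (u , i) ≡ (f u , i)
      F-constant = fibrewise⇒constant connΓ nonbip twinFree C-connected rigid o F F-fibrewise

      G-constant : Σ[ g ∈ (Vertex Γ → Vertex Γ) ] ∀ u i → to G (u , i) ≡ (g u , i)
      G-constant = fibrewise⇒constant connΓ nonbip twinFree C-connected rigid o G G-fibrewise

      f : Vertex Γ → Vertex Γ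
      f = proj₁ F-constant

      F≡ : ∀ u i → to F (u , i) ≡ (f u , i)
      F≡ = proj₂ F-constant

      q : Vertex Γ → Fin n → Fin n
      q u i = proj₂ (from φ (u , i))

      q-next : ∀ {u v} i → Adj Γ u v → Adj Λ (q u i) (q v (cycNext i))
      q-next {u} {v} i e = ∧-conicalʳ _ _ (transfer (φ ⁻¹) {u , i} {v , cycNext i} (∧-true e (C-adj-next i)))

      -- Since φ⁻¹ F = R φ⁻¹, the map `f` on Γ becomes rotation by 2 on the values of `q`.
      q-f : ∀ u i → q (f u) i ≡ cycNext (cycNext (q u i))
      q-f u i = trans (cong (proj₂ ∘ from φ) (≡.sym (F≡ u i))) (cong proj₂ (from∘to φ _))

      module _ (k : Fin n) where

        mirror : ProductSymmetry Γ Λ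
        mirror = conjugate φ (reflection {Γ = Γ} k)

        reflection-commutes : ∀ x → to (reflection {Γ = Γ} k) (to G x) ≡ to G (to (reflection {Γ = Γ} k) x)
        reflection-commutes (u , i) = trans (cong (to (reflection {Γ = Γ} k)) (proj₂ G-constant u i)) (≡.sym (proj₂ G-constant u (reflect k i)))

        -- A reflection commutes with `G` because they act on different coordinates; conjugation by
        -- `φ` turns `G` into `R`.
        mirror-commutes : ∀ x → to mirror (to R x) ≡ to R (to mirror x)
        mirror-commutes x = begin
          to φ (T (from φ (to R x)))                  ≡⟨ cong (to φ ∘ T ∘ from φ ∘ to R) (to∘from φ x) ⟨
          to φ (T (to G (from φ x)))                  ≡⟨ cong (to φ) (reflection-commutes (from φ x)) ⟩
          to φ (to G (T (from φ x)))                  ≡⟨ to∘from φ _ ⟩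
          to R (to φ (T (from φ x)))                  ∎
          where
          open ≡-Reasoning
          T = to (reflection {Γ = Γ} k)

      -- The mirror at q u i fixes (u , i), and splits, so it also fixes (u , i + 1);
      -- hence q u (i + 1) is q u i or its antipode.
      mirror-fixes-next : ∀ u i → to (mirror (q u i)) (u , cycNext i) ≡ (u , cycNext i)
      mirror-fixes-next u i = begin
        to (mirror (q u i)) (u , cycNext i)   ≡⟨ splits u (cycNext i) ⟩
        (α u , β (cycNext i))                 ≡⟨ cong (α u ,_) (proj₂ normal i) ⟩
        (α u , cycNext (β i))                 ≡⟨ cong (λ { (v , j) → v , cycNext j }) (trans (≡.sym (splits u i)) fixed) ⟩
        (u , cycNext i)                       ∎
        where
        open ≡-Reasoning
        normal = normalising⇒splits connΓ nonbip C-connected rigid o o (mirror (q u i)) (mirror-commutes (q u i))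
        α = proj₁ (proj₁ normal)
        β = proj₁ (proj₂ (proj₁ normal))
        splits = proj₂ (proj₂ (proj₁ normal))
        fixed : to (mirror (q u i)) (u , i) ≡ (u , i)
        fixed = trans (cong (λ j → to φ (proj₁ (from φ (u , i)) , j)) (reflect-fixes (q u i))) (to∘from φ (u , i))

      reflect-fixes-next : ∀ u i → reflect (q u i) (q u (cycNext i)) ≡ q u (cycNext i)
      reflect-fixes-next u i = trans (cong proj₂ (≡.sym (from∘to φ _))) (cong (proj₂ ∘ from φ) (mirror-fixes-next u i))

      q-rot : ∀ u i → ∃[ l ] rot l (q u i) ≡ q u (cycNext i)
      q-rot u i = rot-transitive (q u i) (q u (cycNext i))

      m∣q-rot : ∀ u i → m ∣ proj₁ (q-rot u i)
      m∣q-rot u i = *-cancelʳ-∣ 2 (subst (n ∣_) (≡.sym (k*2≡k+k l)) (reflect-fixed⇒∣ (q u i) l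
        (trans (cong (reflect (q u i)) (proj₂ (q-rot u i))) (trans (reflect-fixes-next u i) (≡.sym (proj₂ (q-rot u i)))))))
        where
        l = proj₁ (q-rot u i)

      2∣n : 2 ∣ n
      2∣n = divides m refl

      -- (u , i) and (u , i + 1) need not be adjacent: the flip is known only between adjacent
      -- vertices of `Γ`, and non-bipartiteness carries it back to `u`.
      q-colour : ∀ u i → colour 2∣n (q u (cycNext i)) ≡ not (colour 2∣n (q u i))
      q-colour u i = proj₂ (alternating⇒everywhere connΓ nonbip
        {A = λ v → colour 2∣n (q v i) ≡ c} {B = λ v → colour 2∣n (q v (cycNext i)) ≡ not c} (λ _ → _ ≟ᵇ _) (λ _ → _ ≟ᵇ _)
        (λ {v} {w} e eq → trans (flips v w e) (cong not eq))
        (λ {v} {w} e eq → trans (≡.sym (not-involutive _)) (trans (cong not (trans (≡.sym (flips w v (Adj-sym Γ e))) eq)) (not-involutive c)))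
        u refl u)
        where
        c = colour 2∣n (q u i)
        flips : ∀ v w → Adj Γ v w → colour 2∣n (q w (cycNext i)) ≡ not (colour 2∣n (q v i))
        flips v w e = ¬-not (≢-sym (colour-proper 2∣n (q v i) (q w (cycNext i)) (q-next i e)))

      -- From one column to the next `q u` moves by a multiple of m, and an even move would keep the
      -- colour that `q-colour` flips.
      2∤m : ¬ (2 ∣ m)
      2∤m 2∣m = not-¬ {x = colour 2∣n (q u i₀)} refl
        (trans (≡.sym (colour-rot 2∣n (∣-trans 2∣m (m∣q-rot u i₀)) (q u i₀)))
          (trans (cong (colour 2∣n) (proj₂ (q-rot u i₀))) (q-colour u i₀)))
        where
        u = proj₁ (neighbour-exists connΓ nonbip (base connΓ))

      m∤4 : ¬ (m ∣ 4)
      m∤4 = odd∤4 m 2∤m n∤4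

      h : ℕ
      h = proj₁ (odd⇒suc-even 2∤m)

      m-odd : suc m ≡ h * 2
      m-odd = proj₂ (odd⇒suc-even 2∤m)

      m∣n : m ∣ n
      m∣n = m∣m*n 2

      level : Vertex Γ → Fin m
      level u = reduce m∣n (q u i₀)

      -- Multiples of m vanish in `C m`, so adjacent columns define the same level. An edge of Γ
      -- only compares `q u i₀` with `q v` one column further, and this turns it into an edge
      -- between levels.
      level-next : ∀ u → reduce m∣n (q u (cycNext i₀)) ≡ level u
      level-next u = trans (cong (reduce m∣n) (≡.sym (proj₂ (q-rot u i₀))))
        (trans (reduce-rot m∣n (proj₁ (q-rot u i₀)) (q u i₀)) (rot-multiple (m∣q-rot u i₀) (level u)))

      level-adj : ∀ {u v} → Adj Γ u v → Adj (C m) (level u) (level v)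
      level-adj {u} {v} e = subst (Adj (C m) (level u)) (level-next v)
        (reduce-adj m∣n {q u i₀} {q v (cycNext i₀)} (q-next i₀ e))

      level-f : ∀ u → level (f u) ≡ cycNext (cycNext (level u))
      level-f u = trans (cong (reduce m∣n) (q-f u i₀)) (trans (reduce-next m∣n _) (cong cycNext (reduce-next m∣n _)))

      f-pres : ∀ u v → adj Γ (f u) (f v) ≡ adj Γ u v
      f-pres u v = begin
        adj Γ (f u) (f v)                                   ≡⟨ ∧-identityʳ _ ⟨
        adj Γ (f u) (f v) ∧ true                            ≡⟨ cong (adj Γ (f u) (f v) ∧_) (C-adj-next i₀) ⟨
        productAdj Γ Λ (f u , i₀) (f v , cycNext i₀)        ≡⟨ cong₂ (productAdj Γ Λ) (F≡ u i₀) (F≡ v (cycNext i₀)) ⟨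
        productAdj Γ Λ (to F (u , i₀)) (to F (v , cycNext i₀)) ≡⟨ preserves F (u , i₀) (v , cycNext i₀) ⟩
        productAdj Γ Λ (u , i₀) (v , cycNext i₀)            ≡⟨ cong (adj Γ u v ∧_) (C-adj-next i₀) ⟩
        adj Γ u v ∧ true                                    ≡⟨ ∧-identityʳ _ ⟩
        adj Γ u v                                           ∎
        where open ≡-Reasoning

      -- The m-th power of `F` is conjugate to that of `R`, a rotation by 2m = n.
      f-order : ∀ u → fold u f m ≡ u
      f-order u = cong proj₁ (to-injective (φ ⁻¹) (begin
        from φ (fold u f m , i₀)                            ≡⟨ cong (from φ) (fold-intertwine (_, i₀) (λ v → ≡.sym (F≡ v i₀)) u m) ⟩
        from φ (fold (u , i₀) (to F) m)                     ≡⟨ fold-intertwine (from φ) (λ _ → from∘to φ _) (u , i₀) m ⟩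
        fold (p , k) (to R) m                               ≡⟨ fold-intertwine (p ,_) (λ _ → refl) k m ⟨
        (p , fold k (λ i → cycNext (cycNext i)) m)          ≡⟨ cong (p ,_) (trans (fold-* cycNext 2 m k) (rot-multiple ∣-refl k)) ⟩
        (p , k)                                             ∎))
        where
        open ≡-Reasoning
        p = proj₁ (from φ (u , i₀))
        k = q u i₀

      -- `f` raises levels by 2 and its m-th power is the identity. As 2h = m + 1, this power is a
      -- square root of `f` and raises levels by 1 modulo m.
      lift : Vertex Γ → Vertex Γ
      lift u = fold u f h

      lift² : ∀ u → lift (lift u) ≡ f u
      lift² u = trans (≡.sym (fold-+ u f h)) (trans (cong (fold u f) (trans (≡.sym (k*2≡k+k h)) (≡.sym m-odd))) (cong f (f-order u)))

      lift-order : ∀ u → fold u lift m ≡ u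
      lift-order u = begin
        fold u lift m                        ≡⟨ fold-* f h m u ⟩
        fold u f (m * h)                     ≡⟨ cong (fold u f) (*-comm m h) ⟩
        fold u f (h * m)                     ≡⟨ fold-* f m h u ⟨
        fold u (λ v → fold v f m) h          ≡⟨ fold-cong f-order u h ⟩
        fold u id h                          ≡⟨ fold-id u h ⟩
        u                                    ∎
        where open ≡-Reasoning

      level-lift : ∀ u → level (lift u) ≡ cycNext (level u)
      level-lift u = begin
        level (fold u f h)                              ≡⟨ fold-intertwine level level-f u h ⟩
        fold (level u) (λ i → cycNext (cycNext i)) h    ≡⟨ fold-* cycNext 2 h (level u) ⟩
        rot (h * 2) (level u)                           ≡⟨ cong (λ l → rot l (level u)) m-odd ⟨
        rot (1 + m) (level u)                           ≡⟨ rot-cancel ∣-refl 1 (level u) ⟩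
        cycNext (level u)                               ∎
        where open ≡-Reasoning

      halving : Halving {Γ} {Λ} F
      halving = Halving-conjugate φ (Halving-shift² (neighbour-exists connΓ nonbip) o)

      -- The other half is impossible: there `v` is adjacent to the first coordinate `w` of
      -- `from F (u , i₀)`, which lies two levels below `u`, so `v` is three levels above its
      -- neighbour `w` although m does not divide 4.
      f-adj : ∀ {u v} → Adj Γ u v → level v ≡ cycNext (level u) → Adj Γ (f u) v
      f-adj {u} {v} e up with Halving.split halving {u , i₀} {v , cycNext i₀} (∧-true e (C-adj-next i₀))
      ... | inj₁ e′ = subst (λ x → Adj Γ (proj₁ x) v) (F≡ u i₀) (∧-conicalˡ _ _ e′)
      ... | inj₂ e′ = contradiction (C-neighbours {i = level w} {j = level v} (level-adj (∧-conicalˡ _ _ e′)))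
          [ (λ eq → next²≢ oₘ (level w) (next-injective oₘ (trans (≡.sym ahead) eq)))
          , (λ eq → next³≢prev oₘ (level w) (trans (≡.sym ahead) eq)) ]′
        where
        oₘ = orientation m∤4
        w = proj₁ (from F (u , i₀))
        fw≡u : f w ≡ u
        fw≡u = cong proj₁ (trans (≡.sym (F≡ w (proj₂ (from F (u , i₀))))) (to∘from F (u , i₀)))
        ahead : level v ≡ cycNext (cycNext (cycNext (level w)))
        ahead = trans up (cong cycNext (trans (cong level (≡.sym fw≡u)) (level-f w)))

      Γ-quotient : CyclicQuotient Γ m
      Γ-quotient = record
        { level = level
        ; lift = lift
        ; lift-pres = λ u v → fold-preserves f-pres u v h
        ; lift-order = lift-order
        ; level-lift = level-lift
        ; level-adj = level-adj
        ; lift²-adj = λ {u} {v} e up → subst (λ w → Adj Γ w v) (≡.sym (lift² u)) (f-adj e up)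
        }

    fibrewise⇒¬coprime : 2 ≤ m → ¬ Coprime Γ Λ
    fibrewise⇒¬coprime 2≤m coprime = coprime (C m , 2≤m , cyclicFactor Γ-quotient , cyclicFactor (C-quotient m∤4 h m-odd))

  coprime⇒splits : 2 ≤ m → Coprime Γ Λ → (φ : ProductSymmetry Γ Λ) → Splits {Γ} {Λ} φ
  coprime⇒splits 2≤m coprime φ = by-cases (dichotomy φ) (dichotomy (φ ⁻¹))
    where
    Outcome : ProductSymmetry Γ Λ → Set
    Outcome ψ = (Σ[ o′ ∈ Orientation Λ ] ∀ x → to (conjugate ψ R) x ≡ to (shift² {Γ} {Λ} o′) x) ⊎ (∀ x → proj₂ (to (conjugate ψ R) x) ≡ proj₂ x)
    dichotomy : ∀ ψ → Outcome ψ
    dichotomy ψ = halving-dichotomy connΓ nonbip twinFree C-connected o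
      (Halving-conjugate ψ (Halving-shift² (neighbour-exists connΓ nonbip) o))
    by-cases : Outcome φ → Outcome (φ ⁻¹) → Splits {Γ} {Λ} φ
    by-cases (inj₁ (o′ , F≡)) _ = proj₁ (normalising⇒splits connΓ nonbip C-connected rigid o o′ φ
      (λ x → trans (cong (to φ ∘ to R) (≡.sym (from∘to φ x))) (F≡ (to φ x))))
    -- Here φ⁻¹ R φ = R′, hence φ R′ = R φ: the two orientations change places.
    by-cases (inj₂ _) (inj₁ (o′ , G≡)) = proj₁ (normalising⇒splits connΓ nonbip C-connected rigid o′ o φ
      (λ x → trans (cong (to φ) (≡.sym (G≡ x))) (to∘from φ (to R (to φ x)))))
    by-cases (inj₂ F-fibrewise) (inj₂ G-fibrewise) = contradiction coprime (fibrewise⇒¬coprime φ F-fibrewise G-fibrewise 2≤m)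

-- The second factor `K₂` and the equivalence

twofoldRigid⇒splits-K₂ : ∀ {Γ} → Connected Γ → ¬ Bipartite Γ → TwofoldRigid Γ → (ψ : ProductSymmetry Γ K₂) → Splits {Γ} {K₂} ψ
twofoldRigid⇒splits-K₂ {Γ} connΓ nonbip rigid ψ = (λ u → proj₁ (to ψ (u , zero))) , b u₀ , λ
  { u zero → cong (proj₁ (to ψ (u , zero)) ,_) (proj₁ (b-const u))
  ; u (suc zero) → cong₂ _,_ (≡.sym (rigid a a-pres u)) (trans (proj₂ (b-const u)) (≡.sym (proj₂ (b-const u₀))))
  }
  where
  u₀ = base connΓ

  b : Vertex Γ → Fin 2 → Fin 2
  b u i = proj₂ (to ψ (u , i))

  c : Fin 2
  c = b u₀ zero

  K₂-adj-opposite : ∀ i → Adj K₂ i (opposite i)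
  K₂-adj-opposite zero = refl
  K₂-adj-opposite (suc zero) = refl

  K₂-neighbour : ∀ i j → Adj K₂ i j → j ≡ opposite i
  K₂-neighbour zero (suc zero) _ = refl
  K₂-neighbour (suc zero) zero _ = refl
  K₂-neighbour (suc zero) (suc zero) ()

  b-edge : ∀ {u v} i → Adj Γ u v → b v (opposite i) ≡ opposite (b u i)
  b-edge {u} {v} i e = K₂-neighbour (b u i) (b v (opposite i)) (∧-conicalʳ (adj Γ _ _) _ (transfer ψ {u , i} {v , opposite i} (∧-true e (K₂-adj-opposite i))))

  -- `K₂` has no `Orientation`, so `opposite` takes the role of `next`. The second coordinate
  -- depends on the layer alone, which makes the first coordinates over the two layers a two-fold
  -- automorphism.
  b-const : ∀ v → b v zero ≡ c × b v (suc zero) ≡ opposite c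
  b-const = alternating⇒everywhere connΓ nonbip (λ _ → _ ≟ᶠ _) (λ _ → _ ≟ᶠ _)
    (λ e eq → trans (b-edge zero e) (cong opposite eq))
    (λ e eq → trans (b-edge (suc zero) e) (trans (cong opposite eq) (opposite-involutive c)))
    u₀ refl

  a : Bool → Vertex Γ → Vertex Γ
  a false u = proj₁ (to ψ (u , zero))
  a true u = proj₁ (to ψ (u , suc zero))

  a-pres : ∀ u v → adj Γ (a false u) (a true v) ≡ adj Γ u v
  a-pres u v = begin
    adj Γ (a false u) (a true v)                                           ≡⟨ ∧-identityʳ _ ⟨
    adj Γ (a false u) (a true v) ∧ true                                    ≡⟨ cong (adj Γ (a false u) (a true v) ∧_) opposite-ends ⟨
    productAdj Γ K₂ (to ψ (u , zero)) (to ψ (v , suc zero))                ≡⟨ preserves ψ (u , zero) (v , suc zero) ⟩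
    adj Γ u v ∧ true                                                       ≡⟨ ∧-identityʳ _ ⟩
    adj Γ u v                                                              ∎
    where
    open ≡-Reasoning
    opposite-ends : Adj K₂ (b u zero) (b v (suc zero))
    opposite-ends = subst₂ (Adj K₂) (≡.sym (proj₁ (b-const u))) (≡.sym (proj₂ (b-const v))) (K₂-adj-opposite c)

-- The neighbours of i are those of j; matching i + 1 with j - 1 and i - 1 with j + 1 would give j +
-- 3 = j - 1.
orientation⇒twinFree : ∀ {Λ} → Orientation Λ → TwinFree Λ
orientation⇒twinFree {Λ} o i j same
  with neighbours o (trans (≡.sym (same (next o i))) (adj-next o i)) | neighbours o (trans (≡.sym (same (prev o i))) (adj-prev o i))
... | inj₁ eq | _ = next-injective o eq
... | inj₂ _ | inj₂ eq = next-injective (reversed o) eq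
... | inj₂ eq | inj₁ eq′ = contradiction
  (trans (cong (next o) (trans (cong (next o) (≡.sym eq′)) (next-prev o i))) eq) (next³≢prev o j)

theorem1p7 : (Γ : Graph) (n : ℕ) → 6 ≤ n → Even n →
    NontriviallyUnstablePair Γ (C n) ⇔ (NontriviallyUnstableGraph Γ × Coprime Γ (C n))
theorem1p7 Γ _ 6≤n (divides-refl m) = mk⇔
  (λ { ((coprime , connΓ , _ , twinFree , _ , bip) , unstable) →
       let nonbip = [ (λ { (_ , nonbipC) → contradiction C-bipartite nonbipC }) , proj₁ ]′ bip in
       (connΓ , nonbip , twinFree , λ stable → unstable (C-stable connΓ nonbip twinFree coprime stable)) , coprime })
  (λ { ((connΓ , nonbip , twinFree , unstable) , coprime) →
       (coprime , connΓ , C-connected , twinFree , orientation⇒twinFree (orientation n∤4) , inj₂ (nonbip , C-bipartite)) ,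
       λ stable → unstable (K₂-stable connΓ nonbip twinFree stable) })
  where
  instance
    n-nonZero : NonZero (m * 2)
    n-nonZero = >-nonZero (≤-trans (s≤s z≤n) 6≤n)
    m-nonZero : NonZero m
    m-nonZero = m*n≢0⇒m≢0 m

  n∤4 : ¬ (m * 2 ∣ 4)
  n∤4 n∣4 = <⇒≱ (≤-trans (s≤s (s≤s (s≤s (s≤s (s≤s z≤n))))) 6≤n) (∣⇒≤ n∣4)

  i₀ : Fin (m * 2)
  i₀ = 0 mod (m * 2)

  C-bipartite : Bipartite (C (m * 2))
  C-bipartite = colour (divides m refl) , colour-proper (divides m refl)

  edge : Connected Γ → ¬ Bipartite Γ → ∃[ u ] ∃[ v ] Adj Γ u v
  edge connΓ nonbip = base connΓ , neighbour-exists connΓ nonbip (base connΓ)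

  C-stable : Connected Γ → ¬ Bipartite Γ → TwinFree Γ → Coprime Γ (C (m * 2)) → Stable Γ K₂ → Stable Γ (C (m * 2))
  C-stable connΓ nonbip twinFree coprime stable = splits⇒stable (edge connΓ nonbip) (i₀ , cycNext i₀ , C-adj-next i₀)
    (coprime⇒splits n∤4 connΓ nonbip twinFree
      (stable⇒twofoldRigid twinFree stable (λ i → ⌊ i ≟ᶠ zero ⌋) K₂-proper {zero} {suc zero} refl)
      (≤-trans (s≤s (s≤s z≤n)) (*-cancelʳ-≤ 3 m 2 6≤n)) coprime)
    where
    K₂-proper : ∀ i j → Adj K₂ i j → ⌊ i ≟ᶠ zero ⌋ ≢ ⌊ j ≟ᶠ zero ⌋
    K₂-proper zero (suc zero) _ ()
    K₂-proper (suc zero) zero _ ()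
    K₂-proper (suc zero) (suc zero) ()

  K₂-stable : Connected Γ → ¬ Bipartite Γ → TwinFree Γ → Stable Γ (C (m * 2)) → Stable Γ K₂
  K₂-stable connΓ nonbip twinFree stable = splits⇒stable (edge connΓ nonbip) (zero , suc zero , refl)
    (twofoldRigid⇒splits-K₂ connΓ nonbip
      (stable⇒twofoldRigid twinFree stable (proj₁ C-bipartite) (proj₂ C-bipartite) {i₀} {cycNext i₀} (C-adj-next i₀)))
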